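{- Let $\mu$ be any (Borel) measure on $\mathbb R$. Then: (1) for all partitions $P$ and $Q$ of $\mathbb R$, if $P\subseteq Q$ then $\mu_P\le\mu_Q$; (2) $i[\mu]$ is the directed supremum of ${(\mu_P)}_{P\in\mathcal P}$, where $\mathcal P$ is the set of all partitions of $\mathbb R$, and is therefore a minimal valuation; (3) for every dense subset $D$ of $\mathbb R$, $i[\mu]$ is also the directed supremum of ${(\mu_P)}_{P\in\mathcal P_D}$, where $\mathcal P_D$ is the collection of partitions $P$ with $P\subseteq D$. Here the valuations $\mu_P$ and $i[\mu]$ are taken on $\mathbf I\mathbb R$ (resp., on $\mathbf I\mathbb R_\bot$).
   Context: $\overline{\mathbb R}_+=[0,+\infty]$. $\mathbf I\mathbb R$ is the dcpo of closed intervals $[a,b]$ with $a,b\in\mathbb R$, $a\le b$, ordered by reverse inclusion $\supseteq$; $\mathbf I\mathbb R_\bot$ is $\mathbf I\mathbb R$ with a fresh least element $\bot$ added. Both have their Scott topology. $i\colon\mathbb R\to\mathbf I\mathbb R$ (resp. $\mathbf I\mathbb R_\bot$) is the embedding $a\mapsto[a,a]$. A continuous valuation on a space $X$ is a Scott-continuous map $\nu\colon\mathcal O X\to\overline{\mathbb R}_+$ on the lattice of open sets with $\nu(\emptyset)=0$ and $\nu(U\cup V)+\nu(U\cap V)=\nu(U)+\nu(V)$; $\mathbf V X$ is the dcpo of continuous valuations on $X$, ordered pointwise. Every Borel measure $\mu$ on $\mathbb R$ (values in $\overline{\mathbb R}_+$, no finiteness assumption) restricts to a continuous valuation on $\mathbb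 R$, still written $\mu$, and $i[\mu](V)=\mu(i^{ -1}(V))$ is its image valuation. $\delta_x$ is the Dirac valuation at $x$. A simple valuation is a finite linear combination of Dirac valuations with coefficients in $\mathbb R_+$. The minimal valuations on $X$ are the elements of the smallest subset of $\mathbf V X$ containing all simple valuations and closed under directed suprema taken in $\mathbf V X$. A partition of $\mathbb R$ is a finite non-empty subset $P$ of $\mathbb R$, written $P=\{a_1<\cdots<a_n\}$ with $n\ge1$. For such $P$, $\mu_P=\sum_{i=2}^n\mu(]a_{i-1},a_i])\,\delta_{[a_{i-1},a_i]}$, a valuation on $\mathbf I\mathbb R$ (resp., $\mathbf I\mathbb R_\bot$), where $]a,b]=\{x\mid a<x\le b\}$. -}

module Defs where

open import Algebra.Bundles using (CommutativeMonoid)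
import Algebra.Properties.CommutativeSemigroup as CommutativeSemigroupProperties
open import Axiom.ExcludedMiddle using (ExcludedMiddle)
open import Data.Bool.Base using (if_then_else_)
open import Data.Empty using (⊥; ⊥-elim)
open import Data.Integer.Base using (ℤ; +_; -[1+_])
open import Data.List.Base using (List; []; _∷_; foldr; map)
open import Data.List.Relation.Unary.Linked using (Linked; []; [-]; _∷_)
import Data.List.Relation.Binary.Subset.Setoid as SetoidSubset
open import Data.Nat.Base as ℕ using (ℕ; zero; suc)
import Data.Nat.Properties as ℕ
open import Data.Product.Base using (∃; Σ-syntax; ∃-syntax; _×_; _,_; proj₁; proj₂)
open import Data.Rational.Base as ℚ using (ℚ; 0ℚ; mkℚ)
import Data.Rational.Properties as ℚ
open import Data.Sum.Base using (_⊎_; inj₁; inj₂)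
open import Data.Unit.Polymorphic.Base using (⊤; tt)
open import Function.Base using (_∘_; id; case_of_)
open import Level using (Level; 0ℓ; _⊔_) renaming (suc to ℓsuc)
open import Relation.Binary.Bundles using (Poset; Setoid)
open import Relation.Binary.Core using (Rel)
open import Relation.Binary.Definitions using (tri<; tri≈; tri>)
import Relation.Binary.Construct.Add.Infimum.Equality as AddInfimum
import Relation.Binary.Construct.Add.Infimum.NonStrict as AddInfimum
import Relation.Binary.Reasoning.Setoid as SetoidReasoning
open import Relation.Binary.PropositionalEquality.Core
  using (_≡_; _≢_; refl; sym; trans; cong; subst)
open import Relation.Nullary using (yes; no; does; ¬_; contradiction)
open import Relation.Nullary.Decidable using (True; toWitness; fromWitness; decidable-stable)
open import Relation.Nullary.Construct.Add.Infimum using (_₋; ⊥₋; [_])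
open import Relation.Unary
  using (Pred; _∈_; _∉_; _⊆_; _≐_; ∅; ∁; ⋃; _∩_; _∪_; _∖_) renaming (_⊥_ to Disjoint)

1ℓ : Level
1ℓ = ℓsuc 0ℓ

module _ {c ℓ₁ ℓ₂ : Level} (P : Poset c ℓ₁ ℓ₂) where
  open Poset P using (Carrier; _≤_)

  IsDirected : ∀ {i} {I : Set i} → (I → Carrier) → Set (i ⊔ ℓ₂)
  IsDirected {I = I} f = I × (∀ i j → ∃[ k ] (f i ≤ f k × f j ≤ f k))

  IsSup : ∀ {i} {I : Set i} → (I → Carrier) → Carrier → Set (c ⊔ i ⊔ ℓ₂)
  IsSup f x = (∀ i → f i ≤ x) × (∀ y → (∀ i → f i ≤ y) → x ≤ y)

  IsDirectedSup : ∀ {i} {I : Set i} → (I → Carrier) → Carrier → Set (c ⊔ i ⊔ ℓ₂)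
  IsDirectedSup f x = IsDirected f × IsSup f x

members : ∀ {a} {A : Set a} (S : Pred A 0ℓ) → ∃ S → A
members S = proj₁

-- Subsets are Set-valued predicates throughout. Under excluded middle every
-- predicate, in whatever universe, is equivalent to one of these, so
-- quantifying over Pred A 0ℓ is quantifying over the full powerset of A.
record IsScottContinuous {a ℓ₁ ℓ₂ b ℓ₃ ℓ₄} (P : Poset a ℓ₁ ℓ₂) (Q : Poset b ℓ₃ ℓ₄)
    (f : Poset.Carrier P → Poset.Carrier Q) : Set (1ℓ ⊔ a ⊔ ℓ₂ ⊔ b ⊔ ℓ₄) where
  field
    monotone  : ∀ {x y} → Poset._≤_ P x y → Poset._≤_ Q (f x) (f y)
    preserves : ∀ (S : Pred (Poset.Carrier P) 0ℓ) {x} →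
                IsDirectedSup P (members S) x → IsSup Q (f ∘ members S) (f x)

-- Lower Dedekind cuts: p ∈ lower x means p < x. Classically these are the
-- elements of [-∞,+∞]. A real number is a cut that is neither empty nor full;
-- an element of [0,+∞] is one containing all negative rationals, +∞ being the
-- full cut.
record Cut : Set₁ where
  no-eta-equality
  field
    lower   : Pred ℚ 0ℓ
    down    : ∀ {p q} → p ℚ.≤ q → q ∈ lower → p ∈ lower
    rounded : ∀ {q} → q ∈ lower → ∃[ r ] (q ℚ.< r × r ∈ lower)

record ℝ : Set₁ where
  no-eta-equality
  field
    cut       : Cut
    inhabited : ∃[ q ] q ∈ Cut.lower cut
    bounded   : ∃[ q ] q ∉ Cut.lower cut
  open Cut cut public

infix 4 _≤_ _<_ _≈_

record _≤_ (x y : ℝ) : Set where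
  constructor mk≤
  field incl : ℝ.lower x ⊆ ℝ.lower y

record _<_ (x y : ℝ) : Set where
  constructor mk<
  field
    between : ℚ
    x≤      : between ∉ ℝ.lower x
    <y      : between ∈ ℝ.lower y

_≈_ : ℝ → ℝ → Set
x ≈ y = x ≤ y × y ≤ x

≤-refl : ∀ {x} → x ≤ x
≤-refl = mk≤ id

≤-trans : ∀ {x y z} → x ≤ y → y ≤ z → x ≤ z
≤-trans (mk≤ f) (mk≤ g) = mk≤ (λ q → g (f q))

<⇒≤ : ∀ {x y} → x < y → x ≤ y
<⇒≤ {x} {y} (mk< q q∉x q∈y) = mk≤ λ {p} p∈x → case p ℚ.≤? q of λ where
  (yes p≤q) → ℝ.down y p≤q q∈y
  (no p≰q)  → contradiction (ℝ.down x (ℚ.<⇒≤ (ℚ.≰⇒> p≰q)) p∈x) q∉x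

<-≤-trans : ∀ {x y z} → x < y → y ≤ z → x < z
<-≤-trans (mk< q q∉x q∈y) (mk≤ y≤z) = mk< q q∉x (y≤z q∈y)

≤-<-trans : ∀ {x y z} → x ≤ y → y < z → x < z
≤-<-trans (mk≤ x≤y) (mk< q q∉y q∈z) = mk< q (q∉y ∘ x≤y) q∈z

ℝ-setoid : Setoid 1ℓ 0ℓ
ℝ-setoid = record
  { Carrier       = ℝ
  ; _≈_           = _≈_
  ; isEquivalence = record
    { refl  = ≤-refl , ≤-refl
    ; sym   = λ (p , q) → q , p
    ; trans = λ (p , q) (p′ , q′) → ≤-trans p p′ , ≤-trans q′ q
    }
  }

fromℚ : ℚ → ℝ
fromℚ q = record
  { cut       = record { lower = ℚ._< q ; down = ℚ.≤-<-trans ; rounded = ℚ.<-dense }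
  ; inhabited = q ℚ.- ℚ.1ℚ
              , subst (q ℚ.- ℚ.1ℚ ℚ.<_) (ℚ.+-identityʳ q) (ℚ.+-monoʳ-< q (ℚ.negative⁻¹ (ℚ.- ℚ.1ℚ)))
  ; bounded   = q , ℚ.<-irrefl refl
  }

fromℚ-< : ∀ x {q} → q ∈ ℝ.lower x → fromℚ q < x
fromℚ-< x {q} q∈x = mk< q (ℚ.<-irrefl refl) q∈x

fromℚ-≤ : ∀ x {q} → q ∈ ℝ.lower x → fromℚ q ≤ x
fromℚ-≤ x q∈x = mk≤ (λ p<q → ℝ.down x (ℚ.<⇒≤ p<q) q∈x)

fromℚ-≥ : ∀ x {q} → q ∉ ℝ.lower x → x ≤ fromℚ q
fromℚ-≥ x {q} q∉x = mk≤ λ {p} p∈x → case p ℚ.<? q of λ where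
  (yes p<q) → p<q
  (no p≮q)  → contradiction (ℝ.down x (ℚ.≮⇒≥ p≮q) p∈x) q∉x

fromℚ-> : ∀ x {q r} → q ∉ ℝ.lower x → q ℚ.< r → x < fromℚ r
fromℚ-> x {q} q∉x q<r = mk< q q∉x q<r

]_,_[ : ℝ → ℝ → Pred ℝ 0ℓ
] a , b [ x = a < x × x < b

]_,_] : ℝ → ℝ → Pred ℝ 0ℓ
] a , b ] x = a < x × x ≤ b

record ℝ̄₊ : Set₁ where
  no-eta-equality
  field
    cut    : Cut
    nonneg : ∀ {q} → q ℚ.< 0ℚ → q ∈ Cut.lower cut
  open Cut cut public

infix 4 _≤∞_ _≈∞_

record _≤∞_ (x y : ℝ̄₊) : Set where
  constructor mk≤∞
  field incl : ℝ̄₊.lower x ⊆ ℝ̄₊.lower y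

_≈∞_ : ℝ̄₊ → ℝ̄₊ → Set
x ≈∞ y = x ≤∞ y × y ≤∞ x

IsFinite : ℝ̄₊ → Set
IsFinite x = ∃[ q ] q ∉ ℝ̄₊.lower x

≤∞-refl : ∀ {x} → x ≤∞ x
≤∞-refl = mk≤∞ id

≤∞-trans : ∀ {x y z} → x ≤∞ y → y ≤∞ z → x ≤∞ z
≤∞-trans (mk≤∞ f) (mk≤∞ g) = mk≤∞ (λ q → g (f q))

ℝ̄₊-poset : Poset 1ℓ 0ℓ 0ℓ
ℝ̄₊-poset = record
  { Carrier        = ℝ̄₊
  ; _≈_            = _≈∞_
  ; _≤_            = _≤∞_
  ; isPartialOrder = record
    { isPreorder = record
      { isEquivalence = record
        { refl  = ≤∞-refl , ≤∞-refl
        ; sym   = λ (p , q) → q , p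
        ; trans = λ (p , q) (p′ , q′) → ≤∞-trans p p′ , ≤∞-trans q′ q
        }
      ; reflexive = proj₁
      ; trans     = ≤∞-trans
      }
    ; antisym = _,_
    }
  }

open Poset ℝ̄₊-poset public using ()
  renaming (module Eq to ≈∞)

0∞ : ℝ̄₊
ℝ̄₊.cut    0∞ = record { lower = ℚ._< 0ℚ ; down = ℚ.≤-<-trans ; rounded = ℚ.<-dense }
ℝ̄₊.nonneg 0∞ = id

0∞-minimum : ∀ {x} → 0∞ ≤∞ x
0∞-minimum {x} = mk≤∞ (ℝ̄₊.nonneg x)

private
  split : ∀ q r → q ≡ r ℚ.+ (q ℚ.- r)
  split q r = sym (trans (cong (r ℚ.+_) (ℚ.+-comm q (ℚ.- r)))
    (trans (sym (ℚ.+-assoc r (ℚ.- r) q))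
    (trans (cong (ℚ._+ q) (ℚ.+-inverseʳ r)) (ℚ.+-identityˡ q))))

  q-r<0 : ∀ {q r} → q ℚ.< r → q ℚ.- r ℚ.< 0ℚ
  q-r<0 {q} {r} q<r = subst (q ℚ.- r ℚ.<_) (ℚ.+-inverseʳ r) (ℚ.+-monoˡ-< (ℚ.- r) q<r)

infixl 6 _+∞_

_+∞_ : ℝ̄₊ → ℝ̄₊ → ℝ̄₊
ℝ̄₊.cut (x +∞ y) = record
  { lower   = λ q → ∃[ r ] ∃[ s ] (r ∈ ℝ̄₊.lower x × s ∈ ℝ̄₊.lower y × q ℚ.≤ r ℚ.+ s)
  ; down    = λ p≤q (r , s , r∈x , s∈y , q≤) → r , s , r∈x , s∈y , ℚ.≤-trans p≤q q≤
  ; rounded = λ (r , s , r∈x , s∈y , q≤) →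
      let r′ , r<r′ , r′∈x = ℝ̄₊.rounded x r∈x
      in  r′ ℚ.+ s , ℚ.≤-<-trans q≤ (ℚ.+-monoˡ-< s r<r′) , r′ , s , r′∈x , s∈y , ℚ.≤-refl
  }
ℝ̄₊.nonneg (x +∞ y) {q} q<0 =
  let r , q<r , r<0 = ℚ.<-dense q<0
  in  r , q ℚ.- r , ℝ̄₊.nonneg x r<0 , ℝ̄₊.nonneg y (q-r<0 q<r) , ℚ.≤-reflexive (split q r)

+∞-mono : ∀ {x x′ y y′} → x ≤∞ x′ → y ≤∞ y′ → x +∞ y ≤∞ x′ +∞ y′
+∞-mono (mk≤∞ f) (mk≤∞ g) = mk≤∞ λ (r , s , r∈x , s∈y , q≤) → r , s , f r∈x , g s∈y , q≤

+∞-comm-≤ : ∀ x y → x +∞ y ≤∞ y +∞ x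
+∞-comm-≤ x y = mk≤∞ λ (r , s , r∈x , s∈y , q≤) →
  s , r , s∈y , r∈x , ℚ.≤-trans q≤ (ℚ.≤-reflexive (ℚ.+-comm r s))

+∞-assoc : ∀ x y z → (x +∞ y) +∞ z ≈∞ x +∞ (y +∞ z)
+∞-assoc x y z =
    mk≤∞ (λ (r , s , (r₁ , r₂ , r₁∈ , r₂∈ , r≤) , s∈ , q≤) →
      r₁ , r₂ ℚ.+ s , r₁∈ , (r₂ , s , r₂∈ , s∈ , ℚ.≤-refl) ,
      ℚ.≤-trans q≤ (ℚ.≤-trans (ℚ.+-monoˡ-≤ s r≤) (ℚ.≤-reflexive (ℚ.+-assoc r₁ r₂ s))))
  , mk≤∞ (λ (r , s , r∈ , (s₁ , s₂ , s₁∈ , s₂∈ , s≤) , q≤) →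
      r ℚ.+ s₁ , s₂ , (r , s₁ , r∈ , s₁∈ , ℚ.≤-refl) , s₂∈ ,
      ℚ.≤-trans q≤ (ℚ.≤-trans (ℚ.+-monoʳ-≤ r s≤) (ℚ.≤-reflexive (sym (ℚ.+-assoc r s₁ s₂)))))

+∞-identityʳ : ∀ x → x +∞ 0∞ ≈∞ x
+∞-identityʳ x =
    mk≤∞ (λ (r , s , r∈ , s<0 , q≤) → ℝ̄₊.down x
      (ℚ.≤-trans q≤ (ℚ.≤-trans (ℚ.+-monoʳ-≤ r (ℚ.<⇒≤ s<0)) (ℚ.≤-reflexive (ℚ.+-identityʳ r)))) r∈)
  , mk≤∞ (λ {q} q∈ → let r , q<r , r∈ = ℝ̄₊.rounded x q∈
                     in  r , q ℚ.- r , r∈ , q-r<0 q<r , ℚ.≤-reflexive (split q r))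

+∞-commutativeMonoid : CommutativeMonoid 1ℓ 0ℓ
+∞-commutativeMonoid = record
  { Carrier = ℝ̄₊
  ; _≈_     = _≈∞_
  ; _∙_     = _+∞_
  ; ε       = 0∞
  ; isCommutativeMonoid = record
    { isMonoid = record
      { isSemigroup = record
        { isMagma = record
          { isEquivalence = Poset.isEquivalence ℝ̄₊-poset
          ; ∙-cong = λ (p , q) (p′ , q′) → +∞-mono p p′ , +∞-mono q q′
          }
        ; assoc = +∞-assoc
        }
      ; identity = (λ x → ≈∞.trans (+∞-comm-≤ 0∞ x , +∞-comm-≤ x 0∞) (+∞-identityʳ x))
                 , +∞-identityʳ
      }
    ; comm = λ x y → +∞-comm-≤ x y , +∞-comm-≤ y x
    }
  }

module +∞ = CommutativeMonoid +∞-commutativeMonoid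
open CommutativeSemigroupProperties +∞.commutativeSemigroup public
  using () renaming (interchange to +∞-interchange)

∑ : ℕ → (ℕ → ℝ̄₊) → ℝ̄₊
∑ zero    f = 0∞
∑ (suc n) f = ∑ n f +∞ f n

record Space : Set₂ where
  field
    Carrier    : Set₁
    IsOpen     : Pred (Pred Carrier 0ℓ) 1ℓ
    whole-open : IsOpen (λ _ → ⊤)
    ∩-open     : ∀ {U V} → IsOpen U → IsOpen V → IsOpen (U ∩ V)
    -- Closure under arbitrary unions: U is the union of the open sets it
    -- contains as soon as each of its points lies in one of them.
    ⋃-open     : ∀ {U} → (∀ {x} → x ∈ U → ∃[ V ] (IsOpen V × x ∈ V × V ⊆ U)) → IsOpen U

record Open (X : Space) : Set₁ where
  constructor mkOpen
  field
    {pts}  : Pred (Space.Carrier X) 0ℓ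
    isOpen : Space.IsOpen X pts

open Open using (pts; isOpen)

𝒪 : Space → Poset 1ℓ 1ℓ 1ℓ
𝒪 X = record
  { Carrier        = Open X
  ; _≈_            = λ U V → pts U ≐ pts V
  ; _≤_            = λ U V → pts U ⊆ pts V
  ; isPartialOrder = record
    { isPreorder = record
      { isEquivalence = record
        { refl  = id , id
        ; sym   = λ (p , q) → q , p
        ; trans = λ (p , q) (p′ , q′) → (λ x → p′ (p x)) , (λ x → q (q′ x))
        }
      ; reflexive = proj₁
      ; trans     = λ p q x → q (p x)
      }
    ; antisym = _,_
    }
  }

module _ {X : Space} where
  open Space X

  ∅ᵒ : Open X
  ∅ᵒ = mkOpen {pts = ∅} (⋃-open λ ())

  infixr 7 _∩ᵒ_
  infixr 6 _∪ᵒ_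

  _∩ᵒ_ _∪ᵒ_ : Open X → Open X → Open X
  U ∩ᵒ V = mkOpen (∩-open (isOpen U) (isOpen V))
  U ∪ᵒ V = mkOpen {pts = pts U ∪ pts V} (⋃-open λ where
    (inj₁ x∈U) → pts U , isOpen U , x∈U , inj₁
    (inj₂ x∈V) → pts V , isOpen V , x∈V , inj₂)

record Continuous (X Y : Space) : Set₁ where
  field
    fun           : Space.Carrier X → Space.Carrier Y
    preimage-open : ∀ {V} → Space.IsOpen Y V → Space.IsOpen X (V ∘ fun)

  preimage : Open Y → Open X
  preimage V = mkOpen (preimage-open (isOpen V))

ℚ-below : ∀ {a x} → a < x → ∃[ p ] (a ≤ fromℚ p × p ∈ ℝ.lower x)
ℚ-below {a} (mk< q q∉a q∈x) = q , fromℚ-≥ a q∉a , q∈x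

ℚ-above : ∀ {x b} → x < b → ∃[ q ] (x < fromℚ q × fromℚ q ≤ b)
ℚ-above {x} {b} (mk< q q∉x q∈b) =
  let r , q<r , r∈b = ℝ.rounded b q∈b in r , fromℚ-> x q∉x q<r , fromℚ-≤ b r∈b

upper-bound-below : ∀ {a a′ x} → a < x → a′ < x → ∃[ m ] (a ≤ m × a′ ≤ m × m < x)
upper-bound-below {x = x} a<x a′<x with ℚ-below a<x | ℚ-below a′<x
... | p , a≤p , p∈x | p′ , a′≤p′ , p′∈x with ℚ.≤-total p p′
... | inj₁ p≤p′ = fromℚ p′ , ≤-trans a≤p (mk≤ λ r<p → ℚ.<-≤-trans r<p p≤p′) , a′≤p′ , fromℚ-< x p′∈x
... | inj₂ p′≤p = fromℚ p , a≤p , ≤-trans a′≤p′ (mk≤ λ r<p′ → ℚ.<-≤-trans r<p′ p′≤p) , fromℚ-< x p∈x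

lower-bound-above : ∀ {x b b′} → x < b → x < b′ → ∃[ m ] (x < m × m ≤ b × m ≤ b′)
lower-bound-above x<b x<b′ with ℚ-above x<b | ℚ-above x<b′
... | q , x<q , q≤b | q′ , x<q′ , q′≤b′ with ℚ.≤-total q q′
... | inj₁ q≤q′ = fromℚ q , x<q , q≤b , ≤-trans (mk≤ λ r<q → ℚ.<-≤-trans r<q q≤q′) q′≤b′
... | inj₂ q′≤q = fromℚ q′ , x<q′ , ≤-trans (mk≤ λ r<q′ → ℚ.<-≤-trans r<q′ q′≤q) q≤b , q′≤b′

nbhd : ∀ x → ∃[ a ] ∃[ b ] (x ∈ ] a , b [)
nbhd x =
  let p , p∈x = ℝ.inhabited x
      q , q∉x = ℝ.bounded x
      r , q<r = ℚ-greater q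
  in  fromℚ p , fromℚ r , fromℚ-< x p∈x , fromℚ-> x q∉x q<r
  where
  ℚ-greater : ∀ q → ∃[ r ] q ℚ.< r
  ℚ-greater q = q ℚ.+ ℚ.1ℚ , subst (ℚ._< q ℚ.+ ℚ.1ℚ) (ℚ.+-identityʳ q) (ℚ.+-monoʳ-< q (ℚ.positive⁻¹ ℚ.1ℚ))

]-[-mono : ∀ {a b a′ b′} → a ≤ a′ → b′ ≤ b → ] a′ , b′ [ ⊆ ] a , b [
]-[-mono a≤a′ b′≤b (a′<x , x<b′) = ≤-<-trans a≤a′ a′<x , <-≤-trans x<b′ b′≤b

Euclidean : Space
Euclidean = record
  { Carrier    = ℝ
  ; IsOpen     = λ U → ∀ {x} → x ∈ U → ∃[ a ] ∃[ b ] (x ∈ ] a , b [ × ] a , b [ ⊆ U)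
  ; whole-open = λ {x} _ → let a , b , x∈ = nbhd x in a , b , x∈ , λ _ → tt
  ; ∩-open     = λ U-open V-open (x∈U , x∈V) →
      let a  , b  , (a<x  , x<b)  , ⊆U = U-open x∈U
          a′ , b′ , (a′<x , x<b′) , ⊆V = V-open x∈V
          m , a≤m , a′≤m , m<x = upper-bound-below a<x a′<x
          n , x<n , n≤b , n≤b′ = lower-bound-above x<b x<b′
      in  m , n , (m<x , x<n) , λ y∈ → ⊆U (]-[-mono a≤m n≤b y∈) , ⊆V (]-[-mono a′≤m n≤b′ y∈)
  ; ⋃-open     = λ cover x∈U →
      let V , V-open , x∈V , V⊆U = cover x∈U
          a , b , x∈ , ⊆V        = V-open x∈V
      in  a , b , x∈ , λ y∈ → V⊆U (⊆V y∈)
  }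

Dense : Pred ℝ 0ℓ → Set₁
Dense D = ∀ (U : Open Euclidean) → ∃ (pts U) → ∃[ d ] (d ∈ D × d ∈ pts U)

module _ (P : Poset 1ℓ 1ℓ 1ℓ) where
  open Poset P using () renaming (Carrier to A; _≤_ to _≤ₚ_)

  record IsScottOpen (U : Pred A 0ℓ) : Set₁ where
    field
      upper        : ∀ {x y} → x ≤ₚ y → x ∈ U → y ∈ U
      inaccessible : ∀ (S : Pred A 0ℓ) {x} → IsDirectedSup P (members S) x → x ∈ U →
                     ∃[ y ] (y ∈ S × y ∈ U)

  open IsScottOpen

  Scott : Space
  Scott = record
    { Carrier    = A
    ; IsOpen     = IsScottOpen
    ; whole-open = record
      { upper        = λ _ _ → tt
      ; inaccessible = λ S (((y , y∈S) , _) , _) _ → y , y∈S , tt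
      }
    ; ∩-open     = λ {U} {V} U-open V-open → record
      { upper        = λ x≤y (x∈U , x∈V) → upper U-open x≤y x∈U , upper V-open x≤y x∈V
      ; inaccessible = λ S sup@((_ , dir) , _) (x∈U , x∈V) →
          let y , y∈S , y∈U = inaccessible U-open S sup x∈U
              z , z∈S , z∈V = inaccessible V-open S sup x∈V
              (w , w∈S) , y≤w , z≤w = dir (y , y∈S) (z , z∈S)
          in  w , w∈S , upper U-open y≤w y∈U , upper V-open z≤w z∈V
      }
    ; ⋃-open     = λ cover → record
      { upper        = λ x≤y x∈U →
          let V , V-open , x∈V , V⊆U = cover x∈U in V⊆U (upper V-open x≤y x∈V)
      ; inaccessible = λ S sup x∈U →
          let V , V-open , x∈V , V⊆U = cover x∈U
              y , y∈S , y∈V = inaccessible V-open S sup x∈V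
          in  y , y∈S , V⊆U y∈V
      }
    }

record Interval : Set₁ where
  constructor mkInterval
  field
    {lo} {hi} : ℝ
    lo≤hi     : lo ≤ hi

⟦_⟧ : Interval → Pred ℝ 0ℓ
⟦ I ⟧ x = Interval.lo I ≤ x × x ≤ Interval.hi I

𝐈ℝ : Poset 1ℓ 1ℓ 1ℓ
𝐈ℝ = record
  { Carrier        = Interval
  ; _≈_            = λ I J → ⟦ I ⟧ ≐ ⟦ J ⟧
  ; _≤_            = λ I J → ⟦ J ⟧ ⊆ ⟦ I ⟧
  ; isPartialOrder = record
    { isPreorder = record
      { isEquivalence = record
        { refl  = id , id
        ; sym   = λ (p , q) → q , p
        ; trans = λ (p , q) (p′ , q′) → (λ x → p′ (p x)) , (λ x → q (q′ x))
        }
      ; reflexive = proj₂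
      ; trans     = λ p q x → p (q x)
      }
    ; antisym = λ p q → q , p
    }
  }

𝐈ℝ⊥ : Poset 1ℓ 1ℓ 1ℓ
𝐈ℝ⊥ = record { isPartialOrder = AddInfimum.≤₋-isPartialOrder _ (Poset.isPartialOrder 𝐈ℝ) }

data Version : Set where
  plain lifted : Version

IntervalDomain : Version → Poset 1ℓ 1ℓ 1ℓ
IntervalDomain plain  = 𝐈ℝ
IntervalDomain lifted = 𝐈ℝ⊥

interval : ∀ v → Interval → Poset.Carrier (IntervalDomain v)
interval plain  I = I
interval lifted I = [ I ]

singleton : ℝ → Interval
singleton x = mkInterval (≤-refl {x})

data Borel : Pred ℝ 0ℓ → Set₁ where
  open-set   : ∀ {A} → Space.IsOpen Euclidean A → Borel A
  complement : ∀ {A} → Borel A → Borel (∁ A)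
  union      : ∀ {A : ℕ → Pred ℝ 0ℓ} → (∀ n → Borel (A n)) → Borel (⋃ ℕ A)
  resp       : ∀ {A B} → A ≐ B → Borel A → Borel B

record BorelMeasure : Set₁ where
  field
    measure    : ∀ {A} → Borel A → ℝ̄₊
    cong-≐     : ∀ {A B} (a : Borel A) (b : Borel B) → A ≐ B → measure a ≈∞ measure b
    measure-∅  : (b : Borel ∅) → measure b ≈∞ 0∞
    σ-additive : ∀ {A : ℕ → Pred ℝ 0ℓ} (b : ∀ n → Borel (A n)) →
                 (∀ {m n} → m ≢ n → Disjoint (A m) (A n)) →
                 IsSup ℝ̄₊-poset (λ n → ∑ n (λ k → measure (b k))) (measure (union b))

record Valuation (X : Space) : Set₁ where
  no-eta-equality
  field
    value            : Open X → ℝ̄₊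
    scott-continuous : IsScottContinuous (𝒪 X) ℝ̄₊-poset value
    value-∅          : value ∅ᵒ ≈∞ 0∞
    modular          : ∀ U V → value (U ∪ᵒ V) +∞ value (U ∩ᵒ V) ≈∞ value U +∞ value V
  open IsScottContinuous scott-continuous public

  value-cong : ∀ U V → pts U ≐ pts V → value U ≈∞ value V
  value-cong U V (U⊆V , V⊆U) = monotone {U} {V} U⊆V , monotone {V} {U} V⊆U

open Valuation using (value)

𝐕 : Space → Poset 1ℓ 1ℓ 1ℓ
𝐕 X = record
  { Carrier        = Valuation X
  ; _≈_            = λ μ ν → ∀ U → value μ U ≈∞ value ν U
  ; _≤_            = λ μ ν → ∀ U → value μ U ≤∞ value ν U
  ; isPartialOrder = record
    { isPreorder = record
      { isEquivalence = record
        { refl  = λ _ → ≈∞.refl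
        ; sym   = λ p U → ≈∞.sym (p U)
        ; trans = λ p q U → ≈∞.trans (p U) (q U)
        }
      ; reflexive = λ p U → proj₁ (p U)
      ; trans     = λ p q U → ≤∞-trans (p U) (q U)
      }
    ; antisym = λ p q U → p U , q U
    }
  }

-- The finite non-empty subset {first < … }, listed in increasing order.
record Partition : Set₁ where
  field
    first      : ℝ
    rest       : List ℝ
    increasing : Linked _<_ (first ∷ rest)

  points : List ℝ
  points = first ∷ rest

infix 4 _⊆ₚ_

_⊆ₚ_ : Rel Partition 1ℓ
P ⊆ₚ Q = Partition.points P ⊆ₛ Partition.points Q
  where open SetoidSubset ℝ-setoid renaming (_⊆_ to _⊆ₛ_)

unpair : ℕ → ℕ × ℕ
unpair zero    = 0 , 0
unpair (suc n) = case unpair n of λ where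
  (zero  , b) → suc b , 0
  (suc a , b) → a , suc b

unpair-surjective : ∀ a b → ∃[ n ] unpair n ≡ (a , b)
unpair-surjective a b = go (a ℕ.+ b) a b refl
  where
  go : ∀ s a b → a ℕ.+ b ≡ s → ∃[ n ] unpair n ≡ (a , b)
  go s       a       (suc b) eq with go s (suc a) b (trans (sym (ℕ.+-suc a b)) eq)
  ... | n , n↦ = suc n , next
    where
    next : unpair (suc n) ≡ (a , suc b)
    next rewrite n↦ = refl
  go zero    zero    zero    eq = 0 , refl
  go (suc s) (suc a) zero    eq with go s zero a (trans (sym (ℕ.+-identityʳ a)) (ℕ.suc-injective eq))
  ... | n , n↦ = suc n , next
    where
    next : unpair (suc n) ≡ (suc a , 0)
    next rewrite n↦ = refl

signed : ℕ × ℕ → ℤ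
signed (zero  , m) = + m
signed (suc _ , m) = -[1+ m ]

ℤ-enum : ℕ → ℤ
ℤ-enum n = signed (unpair n)

ℤ-enum-surjective : ∀ i → ∃[ n ] ℤ-enum n ≡ i
ℤ-enum-surjective (+ m)    = let n , n↦ = unpair-surjective 0 m in n , cong signed n↦
ℤ-enum-surjective -[1+ m ] = let n , n↦ = unpair-surjective 1 m in n , cong signed n↦

ℚ-enum : ℕ → ℚ
ℚ-enum n = ℤ-enum (proj₁ (unpair n)) ℚ./ suc (proj₂ (unpair n))

ℚ-enum-surjective : ∀ q → ∃[ n ] ℚ-enum n ≡ q
ℚ-enum-surjective q@(mkℚ i d-1 _) with ℤ-enum-surjective i
... | k , k↦ with unpair-surjective k d-1
... | n , n↦ = n , trans (cong (λ (k , d) → ℤ-enum k ℚ./ suc d) n↦)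
                  (trans (cong (ℚ._/ suc d-1) k↦) (ℚ.↥p/↧p≡p q))

ℚ-interval : ℕ → Pred ℝ 0ℓ
ℚ-interval n = ] fromℚ (ℚ-enum (proj₁ (unpair n))) , fromℚ (ℚ-enum (proj₂ (unpair n))) [

ℚ-interval-surjective : ∀ p q → ∃[ n ] ℚ-interval n ≡ ] fromℚ p , fromℚ q [
ℚ-interval-surjective p q with ℚ-enum-surjective p | ℚ-enum-surjective q
... | j , refl | k , refl with unpair-surjective j k
... | n , n↦ = n , cong (λ (j , k) → ] fromℚ (ℚ-enum j) , fromℚ (ℚ-enum k) [) n↦

-- Excluded middle is the ambient logic of measure theory and Scott topologies,
-- not an assumption on the objects; it is not derivable in Agda, so it is a
-- parameter.
module Classical (em : ∀ {ℓ} → ExcludedMiddle ℓ) where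

  by-contradiction : ∀ {p} {P : Set p} → ¬ ¬ P → P
  by-contradiction = decidable-stable em

  -- The Set-valued predicate equivalent to P.
  record ⌈_⌉ {a p} {A : Set a} (P : Pred A p) (x : A) : Set where
    constructor squash
    field squashed : True (em {P = P x})

  to⌈⌉ : ∀ {a p} {A : Set a} {P : Pred A p} {x} → P x → x ∈ ⌈ P ⌉
  to⌈⌉ p = squash (fromWitness p)

  from⌈⌉ : ∀ {a p} {A : Set a} {P : Pred A p} {x} → x ∈ ⌈ P ⌉ → P x
  from⌈⌉ (squash p) = toWitness p

  module _ {a ℓ₁ ℓ₂ b ℓ₃ ℓ₄} {P : Poset a ℓ₁ ℓ₂} {Q : Poset b ℓ₃ ℓ₄}
           {f : Poset.Carrier P → Poset.Carrier Q} (f-cont : IsScottContinuous P Q f) where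
    open IsScottContinuous f-cont

    preserves-family : ∀ {i} {I : Set i} {g : I → Poset.Carrier P} {x} →
                       IsDirectedSup P g x → IsSup Q (f ∘ g) (f x)
    preserves-family {g = g} {x} ((i₀ , dir) , ub , least) =
        (λ i → monotone (ub i))
      , λ y f≤y → proj₂ (preserves S ((toS i₀ , S-dir) , S-ub , S-least)) y
          λ (z , z∈S) → subst (λ w → Poset._≤_ Q (f w) y) (proj₂ (from⌈⌉ z∈S)) (f≤y _)
      where
      S : Pred (Poset.Carrier P) 0ℓ
      S = ⌈ (λ z → ∃[ i ] g i ≡ z) ⌉
      toS : ∀ i → ∃ S
      toS i = g i , to⌈⌉ (i , refl)
      S-dir : ∀ (u v : ∃ S) → ∃[ w ] (Poset._≤_ P (proj₁ u) (proj₁ w) × Poset._≤_ P (proj₁ v) (proj₁ w))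
      S-dir (u , u∈S) (v , v∈S) with from⌈⌉ u∈S | from⌈⌉ v∈S
      ... | i , refl | j , refl = let k , i≤k , j≤k = dir i j in toS k , i≤k , j≤k
      S-ub : ∀ (u : ∃ S) → Poset._≤_ P (proj₁ u) x
      S-ub (u , u∈S) with from⌈⌉ u∈S
      ... | i , refl = ub i
      S-least : ∀ y → (∀ (u : ∃ S) → Poset._≤_ P (proj₁ u) y) → Poset._≤_ P x y
      S-least y S≤y = least y (λ i → S≤y (toS i))

  sup-∈ℝ̄₊ : ∀ {i} {I : Set i} {f : I → ℝ̄₊} {x} → I → IsSup ℝ̄₊-poset f x →
            ∀ {q} → q ∈ ℝ̄₊.lower x → ∃[ i ] q ∈ ℝ̄₊.lower (f i)
  sup-∈ℝ̄₊ {f = f} {x} i₀ (_ , least) {q} q∈x = by-contradiction λ none →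
    case _≤∞_.incl (least cap λ i → mk≤∞ λ {p} p∈ → case p ℚ.<? q of λ where
      (yes p<q) → inj₁ p<q
      (no p≮q)  → contradiction (i , ℝ̄₊.down (f i) (ℚ.≮⇒≥ p≮q) p∈) none) q∈x of λ where
      (inj₁ q<q) → ℚ.<-irrefl refl q<q
      (inj₂ q<0) → none (i₀ , ℝ̄₊.nonneg (f i₀) q<0)
    where
    cap : ℝ̄₊
    cap = record
      { cut = record
        { lower   = λ p → p ℚ.< q ⊎ p ℚ.< 0ℚ
        ; down    = λ where
            r≤p (inj₁ p<q) → inj₁ (ℚ.≤-<-trans r≤p p<q)
            r≤p (inj₂ p<0) → inj₂ (ℚ.≤-<-trans r≤p p<0)
        ; rounded = λ where
            (inj₁ p<q) → let r , p<r , r<q = ℚ.<-dense p<q in r , p<r , inj₁ r<q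
            (inj₂ p<0) → let r , p<r , r<0 = ℚ.<-dense p<0 in r , p<r , inj₂ r<0
        }
      ; nonneg = inj₂
      }

  sup-∈𝒪 : ∀ {X} {i} {I : Set i} {f : I → Open X} {U} → IsSup (𝒪 X) f U →
           ∀ {x} → x ∈ pts U → ∃[ i ] x ∈ pts (f i)
  sup-∈𝒪 {X} {f = f} (_ , least) x∈U =
    from⌈⌉ (least ⋃f (λ i x∈ → to⌈⌉ (i , x∈)) x∈U)
    where
    union-pts : Pred (Space.Carrier X) 0ℓ
    union-pts = ⌈ (λ x → ∃[ i ] x ∈ pts (f i)) ⌉

    ⋃f : Open X
    ⋃f = mkOpen {pts = union-pts} (Space.⋃-open X {union-pts} λ x∈ →
      let i , x∈fi = from⌈⌉ x∈
      in  pts (f i) , isOpen (f i) , x∈fi , λ y∈ → to⌈⌉ (i , y∈))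

  module _ {X : Space} where

    0ᵛ : Valuation X
    0ᵛ = record
      { value            = λ _ → 0∞
      ; scott-continuous = record
        { monotone  = λ _ → ≤∞-refl
        ; preserves = λ S _ → (λ _ → ≤∞-refl) , λ _ _ → 0∞-minimum
        }
      ; value-∅          = ≈∞.refl
      ; modular          = λ _ _ → ≈∞.refl
      }

    infixl 6 _+ᵛ_

    _+ᵛ_ : Valuation X → Valuation X → Valuation X
    μ +ᵛ ν = record
      { value            = λ U → value μ U +∞ value ν U
      ; scott-continuous = record
        { monotone  = λ U⊆V → +∞-mono (Valuation.monotone μ U⊆V) (Valuation.monotone ν U⊆V)
        ; preserves = λ S {U} sup@((s₀ , dir) , ub , _) →
            (λ s → +∞-mono (Valuation.monotone μ (ub s)) (Valuation.monotone ν (ub s))) ,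
            λ y S≤y → mk≤∞ λ (r , s , r∈ , s∈ , q≤) →
              let V , r∈V = sup-∈ℝ̄₊ s₀ (Valuation.preserves μ S sup) r∈
                  W , s∈W = sup-∈ℝ̄₊ s₀ (Valuation.preserves ν S sup) s∈
                  T , V⊆T , W⊆T = dir V W
              in  _≤∞_.incl (S≤y T)
                    ( r , s
                    , _≤∞_.incl (Valuation.monotone μ V⊆T) r∈V
                    , _≤∞_.incl (Valuation.monotone ν W⊆T) s∈W
                    , q≤)
        }
      ; value-∅          = ≈∞.trans (+∞.∙-cong (Valuation.value-∅ μ) (Valuation.value-∅ ν)) (+∞-identityʳ 0∞)
      ; modular          = λ U V → ≈∞.trans (+∞-interchange _ _ _ _)
          (≈∞.trans (+∞.∙-cong (Valuation.modular μ U V) (Valuation.modular ν U V))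
                    (+∞-interchange _ _ _ _))
      }

    infix 8 _·δ_

    -- c δₓ, with the usual convention +∞ · 0 = 0. Since δₓ only takes the
    -- values 0 and 1, no multiplication on [0,+∞] is needed.
    _·δ_ : ℝ̄₊ → Space.Carrier X → Valuation X
    c ·δ x = record
      { value            = val
      ; scott-continuous = record
        { monotone  = λ {U} {V} → mono {U} {V}
        ; preserves = λ S {U} (_ , sup) →
            (λ s → mono {proj₁ s} {U} (proj₁ sup s)) ,
            λ y S≤y → case em {P = x ∈ pts U} of λ where
              (yes x∈U) → let s , x∈s = sup-∈𝒪 {f = members S} {U = U} sup x∈U
                          in  ≤∞-trans (proj₁ (in-≈ U x∈U))
                                (≤∞-trans (proj₂ (in-≈ (proj₁ s) x∈s)) (S≤y s))
              (no x∉U)  → ≤∞-trans (proj₁ (out-≈ U x∉U)) 0∞-minimum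
        }
      ; value-∅          = out-≈ ∅ᵒ (λ ())
      ; modular          = modular′
      }
      where
      val : Open X → ℝ̄₊
      val U = if does (em {P = x ∈ pts U}) then c else 0∞

      in-≈ : ∀ U → x ∈ pts U → val U ≈∞ c
      in-≈ U x∈U with em {P = x ∈ pts U}
      ... | yes _  = ≈∞.refl
      ... | no x∉U = contradiction x∈U x∉U

      out-≈ : ∀ U → x ∉ pts U → val U ≈∞ 0∞
      out-≈ U x∉U with em {P = x ∈ pts U}
      ... | yes x∈U = contradiction x∈U x∉U
      ... | no _    = ≈∞.refl

      mono : ∀ {U V} → pts U ⊆ pts V → val U ≤∞ val V
      mono {U} {V} U⊆V = case em {P = x ∈ pts U} of λ where
        (yes x∈U) → ≤∞-trans (proj₁ (in-≈ U x∈U)) (proj₂ (in-≈ V (U⊆V x∈U)))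
        (no x∉U)  → ≤∞-trans (proj₁ (out-≈ U x∉U)) 0∞-minimum

      modular′ : ∀ U V → val (U ∪ᵒ V) +∞ val (U ∩ᵒ V) ≈∞ val U +∞ val V
      modular′ U V with em {P = x ∈ pts U} | em {P = x ∈ pts V}
      ... | yes x∈U | yes x∈V = +∞.∙-cong (in-≈ (U ∪ᵒ V) (inj₁ x∈U)) (in-≈ (U ∩ᵒ V) (x∈U , x∈V))
      ... | yes x∈U | no x∉V  = +∞.∙-cong (in-≈ (U ∪ᵒ V) (inj₁ x∈U)) (out-≈ (U ∩ᵒ V) (x∉V ∘ proj₂))
      ... | no x∉U  | yes x∈V = ≈∞.trans (+∞.comm _ _)
        (+∞.∙-cong (out-≈ (U ∩ᵒ V) (x∉U ∘ proj₁)) (in-≈ (U ∪ᵒ V) (inj₂ x∈V)))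
      ... | no x∉U  | no x∉V  = +∞.∙-cong
        (out-≈ (U ∪ᵒ V) λ where (inj₁ x∈U) → x∉U x∈U
                                (inj₂ x∈V) → x∉V x∈V)
        (out-≈ (U ∩ᵒ V) (x∉U ∘ proj₁))

    IsSimple : Valuation X → Set₁
    IsSimple ν = ∃[ terms ] Poset._≈_ (𝐕 X) ν (foldr _+ᵛ_ 0ᵛ (map term terms))
      where
      term : ∃ IsFinite × Space.Carrier X → Valuation X
      term ((r , _) , x) = r ·δ x

    data IsMinimal : Valuation X → Set₁ where
      simple       : ∀ {ν} → IsSimple ν → IsMinimal ν
      directed-sup : ∀ (S : Pred (Valuation X) 0ℓ) {ν} → S ⊆ IsMinimal →
                     IsDirectedSup (𝐕 X) (members S) ν → IsMinimal ν

  image : ∀ {X Y} → Continuous X Y → Valuation X → Valuation Y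
  image {X} {Y} f ν = record
    { value            = λ V → value ν (preimage V)
    ; scott-continuous = record
      { monotone  = λ U⊆V → Valuation.monotone ν U⊆V
      ; preserves = λ S {U} ((s₀ , dir) , sup) →
          preserves-family (Valuation.scott-continuous ν) {g = preimage ∘ members S} {preimage U}
            ( (s₀ , λ s t → let u , s⊆u , t⊆u = dir s t in u , s⊆u , t⊆u)
            , (λ s x∈ → proj₁ sup s x∈)
            , λ W S≤W x∈ → let s , x∈s = sup-∈𝒪 {f = members S} {U = U} sup x∈ in S≤W s x∈s)
      }
    ; value-∅          = ≈∞.trans (Valuation.value-cong ν (preimage ∅ᵒ) ∅ᵒ (id , id)) (Valuation.value-∅ ν)
    ; modular          = λ U V → ≈∞.trans
        (+∞.∙-cong
          (Valuation.value-cong ν (preimage (U ∪ᵒ V)) (preimage U ∪ᵒ preimage V) (id , id))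
          (Valuation.value-cong ν (preimage (U ∩ᵒ V)) (preimage U ∩ᵒ preimage V) (id , id)))
        (Valuation.modular ν (preimage U) (preimage V))
    }
    where open Continuous f using (preimage)

  Borel-∅ : Borel ∅
  Borel-∅ = open-set λ ()

  two : Pred ℝ 0ℓ → Pred ℝ 0ℓ → ℕ → Pred ℝ 0ℓ
  two A B 0             = A
  two A B 1             = B
  two A B (suc (suc _)) = ∅

  Borel-two : ∀ {A B} → Borel A → Borel B → ∀ n → Borel (two A B n)
  Borel-two a b 0             = a
  Borel-two a b 1             = b
  Borel-two a b (suc (suc _)) = Borel-∅

  ⋃-two : ∀ A B → ⋃ ℕ (two A B) ≐ A ∪ B
  ⋃-two A B = (λ where (0 , x∈A) → inj₁ x∈A
                       (1 , x∈B) → inj₂ x∈B)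
            , (λ where (inj₁ x∈A) → 0 , x∈A
                       (inj₂ x∈B) → 1 , x∈B)

  Borel-∪ : ∀ {A B} → Borel A → Borel B → Borel (A ∪ B)
  Borel-∪ a b = resp (⋃-two _ _) (union (Borel-two a b))

  Borel-∖ : ∀ {A B} → Borel A → Borel B → Borel (A ∖ B)
  Borel-∖ a b = resp
    ( (λ x∉ → by-contradiction (λ x∉A → x∉ (inj₁ x∉A)) , λ x∈B → x∉ (inj₂ x∈B))
    , (λ where (x∈A , x∉B) (inj₁ x∉A) → x∉A x∈A
               (x∈A , x∉B) (inj₂ x∈B) → x∉B x∈B) )
    (complement (Borel-∪ (complement a) b))

  Borel-]_,+∞[ : ∀ a → Borel (a <_)
  Borel-] a ,+∞[ = open-set λ {x} a<x →
    let _ , r , _ , x<r = nbhd x in a , r , (a<x , x<r) , proj₁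

  ≮⇒≥ : ∀ {x y} → ¬ x < y → y ≤ x
  ≮⇒≥ x≮y = mk≤ λ {q} q∈y → by-contradiction λ q∉x → x≮y (mk< q q∉x q∈y)

  Borel-]_,_] : ∀ a b → Borel (] a , b ])
  Borel-] a , b ] = resp
    ( (λ (a<x , b≮x) → a<x , ≮⇒≥ b≮x)
    , (λ (a<x , x≤b) → a<x , λ (mk< q q∉b q∈x) → q∉b (_≤_.incl x≤b q∈x)) )
    (Borel-∖ Borel-] a ,+∞[ Borel-] b ,+∞[)

  module _ (μ : BorelMeasure) where
    open BorelMeasure μ

    additive : ∀ {A B C} (a : Borel A) (b : Borel B) (c : Borel C) →
               Disjoint A B → C ≐ A ∪ B → measure c ≈∞ measure a +∞ measure b
    additive {A} {B} a b c A⊥B (C⊆ , ⊆C) = ≈∞.trans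
      (cong-≐ c (union ab) ((λ x∈ → proj₂ (⋃-two A B) (C⊆ x∈)) , (λ x∈ → ⊆C (proj₁ (⋃-two A B) x∈))))
      ( proj₂ sup _ partial≤
      , ≤∞-trans (+∞-mono (proj₂ (+∞.identityˡ (measure a))) ≤∞-refl) (proj₁ sup 2) )
      where
      ab = Borel-two a b
      disjoint : ∀ {m n} → m ≢ n → Disjoint (two A B m) (two A B n)
      disjoint {0}           {0}           m≢n _         = m≢n refl
      disjoint {0}           {1}           _   x∈        = A⊥B x∈
      disjoint {0}           {suc (suc _)} _   (_ , ())
      disjoint {1}           {0}           _   (x∈B , x∈A) = A⊥B (x∈A , x∈B)
      disjoint {1}           {1}           m≢n _         = m≢n refl
      disjoint {1}           {suc (suc _)} _   (_ , ())
      disjoint {suc (suc _)} {_}           _   (() , _)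
      sup = σ-additive ab disjoint
      partial≤ : ∀ n → ∑ n (λ k → measure (ab k)) ≤∞ measure a +∞ measure b
      partial≤ 0                   = 0∞-minimum
      partial≤ 1                   = ≤∞-trans (proj₁ (+∞.comm _ _)) (+∞-mono ≤∞-refl 0∞-minimum)
      partial≤ 2                   = +∞-mono (proj₁ (+∞.identityˡ _)) ≤∞-refl
      partial≤ (suc n@(suc (suc _))) = ≤∞-trans
        (+∞-mono (partial≤ n) (proj₁ (measure-∅ Borel-∅))) (proj₁ (+∞-identityʳ _))

    measure-mono : ∀ {A B} (a : Borel A) (b : Borel B) → A ⊆ B → measure a ≤∞ measure b
    measure-mono {A} {B} a b A⊆B = ≤∞-trans
      (≤∞-trans (proj₂ (+∞-identityʳ _)) (+∞-mono ≤∞-refl 0∞-minimum))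
      (proj₂ (additive a (Borel-∖ b a) b (λ (x∈A , _ , x∉A) → x∉A x∈A)
        ( (λ {x} x∈B → case em {P = x ∈ A} of λ where
            (yes x∈A) → inj₁ x∈A
            (no x∉A)  → inj₂ (x∈B , x∉A))
        , (λ where (inj₁ x∈A)       → A⊆B x∈A
                   (inj₂ (x∈B , _)) → x∈B) )))

    continuous-from-below :
      ∀ {B : ℕ → Pred ℝ 0ℓ} (b : ∀ n → Borel (B n)) → B 0 ⊆ ∅ → (∀ n → B n ⊆ B (suc n)) →
      IsSup ℝ̄₊-poset (λ n → measure (b n)) (measure (union b))
    continuous-from-below {B} b B₀⊆∅ B⊆ =
        (λ n → measure-mono (b n) (union b) (n ,_))
      , λ y b≤y → ≤∞-trans (measure-mono (union b) (union c) (λ (n , x∈) → ⋃B⊆⋃C n x∈))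
          (proj₂ (σ-additive c disjoint) y (λ n → ≤∞-trans (proj₁ (∑-C n)) (b≤y n)))
      where
      C : ℕ → Pred ℝ 0ℓ
      C n = B (suc n) ∖ B n
      c : ∀ n → Borel (C n)
      c n = Borel-∖ (b (suc n)) (b n)
      B-mono : ∀ {m n} → m ℕ.≤′ n → B m ⊆ B n
      B-mono ℕ.≤′-refl       = id
      B-mono (ℕ.≤′-step m≤n) = λ x∈ → B⊆ _ (B-mono m≤n x∈)
      disjoint : ∀ {m n} → m ≢ n → Disjoint (C m) (C n)
      disjoint {m} {n} m≢n ((x∈Bm′ , x∉Bm) , (x∈Bn′ , x∉Bn)) with ℕ.<-cmp m n
      ... | tri< m<n _ _ = x∉Bn (B-mono (ℕ.≤⇒≤′ m<n) x∈Bm′)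
      ... | tri≈ _ m≡n _ = m≢n m≡n
      ... | tri> _ _ n<m = x∉Bm (B-mono (ℕ.≤⇒≤′ n<m) x∈Bn′)
      ∑-C : ∀ n → ∑ n (λ k → measure (c k)) ≈∞ measure (b n)
      ∑-C zero    = ≈∞.sym (≈∞.trans (cong-≐ (b 0) Borel-∅ (B₀⊆∅ , λ ())) (measure-∅ Borel-∅))
      ∑-C (suc n) = ≈∞.trans (+∞.∙-cong (∑-C n) ≈∞.refl)
        (≈∞.sym (additive (b n) (c n) (b (suc n)) (λ (x∈ , _ , x∉) → x∉ x∈)
          ( (λ {x} x∈′ → case em {P = x ∈ B n} of λ where
              (yes x∈) → inj₁ x∈
              (no x∉)  → inj₂ (x∈′ , x∉))
          , (λ where (inj₁ x∈)        → B⊆ n x∈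
                     (inj₂ (x∈′ , _)) → x∈′) )))
      ⋃B⊆⋃C : ∀ n {x} → x ∈ B n → x ∈ ⋃ ℕ C
      ⋃B⊆⋃C zero    x∈ = ⊥-elim (B₀⊆∅ x∈)
      ⋃B⊆⋃C (suc n) {x} x∈ = case em {P = x ∈ B n} of λ where
        (yes x∈Bn) → ⋃B⊆⋃C n x∈Bn
        (no x∉Bn)  → n , x∈ , x∉Bn

    restriction : Valuation Euclidean
    restriction = record
      { value            = λ U → measure (open-set (isOpen U))
      ; scott-continuous = record
        { monotone  = λ {U} {V} U⊆V → measure-mono (open-set (isOpen U)) (open-set (isOpen V)) U⊆V
        ; preserves = λ S {U} (dir , sup) →
            (λ s → measure-mono (open-set (isOpen (proj₁ s))) (open-set (isOpen U)) (proj₁ sup s)) ,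
            lindelöf S U dir sup
        }
      ; value-∅          = measure-∅ (open-set (isOpen {Euclidean} ∅ᵒ))
      ; modular          = modular′
      }
      where
      modular′ : ∀ (U V : Open Euclidean) →
                 measure (open-set (isOpen (U ∪ᵒ V))) +∞ measure (open-set (isOpen (U ∩ᵒ V))) ≈∞
                 measure (open-set (isOpen U)) +∞ measure (open-set (isOpen V))
      modular′ U V = begin
        measure (open-set (isOpen (U ∪ᵒ V))) +∞ measure u∩v
          ≈⟨ +∞.∙-cong (additive u (Borel-∖ v u) (open-set (isOpen (U ∪ᵒ V))) (λ (x∈U , _ , x∉U) → x∉U x∈U)
               ( (λ {x} x∈ → case em {P = x ∈ pts U} of λ where
                   (yes x∈U) → inj₁ x∈U
                   (no x∉U)  → inj₂ ((case x∈ of λ where (inj₁ x∈U) → contradiction x∈U x∉U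
                                                         (inj₂ x∈V) → x∈V) , x∉U))
               , (λ where (inj₁ x∈U)       → inj₁ x∈U
                          (inj₂ (x∈V , _)) → inj₂ x∈V) )) ≈∞.refl ⟩
        (measure u +∞ measure (Borel-∖ v u)) +∞ measure u∩v
          ≈⟨ +∞.assoc _ _ _ ⟩
        measure u +∞ (measure (Borel-∖ v u) +∞ measure u∩v)
          ≈⟨ +∞.∙-cong ≈∞.refl (≈∞.sym (additive (Borel-∖ v u) u∩v v (λ ((_ , x∉U) , x∈U , _) → x∉U x∈U)
               ( (λ {x} x∈V → case em {P = x ∈ pts U} of λ where
                   (yes x∈U) → inj₂ (x∈U , x∈V)
                   (no x∉U)  → inj₁ (x∈V , x∉U))
               , (λ where (inj₁ (x∈V , _)) → x∈V
                          (inj₂ (_ , x∈V)) → x∈V) ))) ⟩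
        measure u +∞ measure v ∎
        where
        open SetoidReasoning +∞.setoid
        u = open-set (isOpen U)
        v = open-set (isOpen V)
        u∩v = open-set (isOpen (U ∩ᵒ V))

      lindelöf : ∀ (S : Pred (Open Euclidean) 0ℓ) U → IsDirected (𝒪 Euclidean) (members S) →
                 IsSup (𝒪 Euclidean) (members S) U →
                 ∀ y → (∀ (s : ∃ S) → measure (open-set (isOpen (proj₁ s))) ≤∞ y) →
                 measure (open-set (isOpen U)) ≤∞ y
      lindelöf S U (s₀ , dir) sup y S≤y = ≤∞-trans
        (measure-mono (open-set (isOpen U)) (union b) U⊆⋃B)
        (proj₂ (continuous-from-below b (λ x∈ → x∈) (λ _ → inj₁)) y λ n →
          let s , B⊆s = B-inside n
          in  ≤∞-trans (measure-mono (b n) (open-set (isOpen (proj₁ s))) B⊆s) (S≤y s))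
        where
        Inside : Pred ℕ 1ℓ
        Inside n = Σ[ s ∈ ∃ S ] ℚ-interval n ⊆ pts (proj₁ s)
        A B : ℕ → Pred ℝ 0ℓ
        A n x = x ∈ ℚ-interval n × n ∈ ⌈ Inside ⌉
        B zero    = ∅
        B (suc n) = B n ∪ A n
        B-open : ∀ n → Space.IsOpen Euclidean (B n)
        B-open (suc n) (inj₁ x∈B) =
          let a , b , x∈ , ⊆B = B-open n x∈B in a , b , x∈ , λ y∈ → inj₁ (⊆B y∈)
        B-open (suc n) (inj₂ (x∈ , good)) = _ , _ , x∈ , λ y∈ → inj₂ (y∈ , good)
        b : ∀ n → Borel (B n)
        b n = open-set (B-open n)
        B-inside : ∀ n → Σ[ s ∈ ∃ S ] B n ⊆ pts (proj₁ s)
        B-inside zero    = s₀ , λ ()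
        B-inside (suc n) with B-inside n | em {P = Inside n}
        ... | s , B⊆s | yes (t , I⊆t) = let u , s⊆u , t⊆u = dir s t in
          u , λ where (inj₁ x∈B)        → s⊆u (B⊆s x∈B)
                      (inj₂ (x∈I , _))  → t⊆u (I⊆t x∈I)
        ... | s , B⊆s | no ¬inside = s , λ where
          (inj₁ x∈B)        → B⊆s x∈B
          (inj₂ (_ , good)) → contradiction (from⌈⌉ good) ¬inside
        U⊆⋃B : pts U ⊆ ⋃ ℕ B
        U⊆⋃B {x} x∈U =
          let s , x∈s                = sup-∈𝒪 {f = members S} {U = U} sup x∈U
              a , c , (a<x , x<c) , ⊆s = isOpen (proj₁ s) x∈s
              p , a≤p , p∈x          = ℚ-below a<x
              q , x<q , q≤c          = ℚ-above x<c
              n , n↦                 = ℚ-interval-surjective p q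
              I⊆s : ℚ-interval n ⊆ pts (proj₁ s)
              I⊆s {z} y∈ = ⊆s (]-[-mono a≤p q≤c (subst (z ∈_) n↦ y∈))
          in  suc n , inj₂ (subst (x ∈_) (sym n↦) (fromℚ-< x p∈x , x<q) , to⌈⌉ (s , λ {_} → I⊆s))

  singleton-open : ∀ {V} → Space.IsOpen (Scott 𝐈ℝ) V → Space.IsOpen Euclidean (V ∘ singleton)
  singleton-open {V} V-open {x} x∈V =
    let I , (lo<x , x<hi) , I∈V = IsScottOpen.inaccessible V-open Around (directed , ub , least) x∈V
    in  Interval.lo I , Interval.hi I , (lo<x , x<hi) , λ (lo<y , y<hi) →
          IsScottOpen.upper V-open (λ (y≤z , z≤y) → ≤-trans (<⇒≤ lo<y) y≤z , ≤-trans z≤y (<⇒≤ y<hi)) I∈V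
    where
    Around : Pred Interval 0ℓ
    Around I = x ∈ ] Interval.lo I , Interval.hi I [
    directed : IsDirected 𝐈ℝ (members Around)
    directed =
        (let a , b , a<x , x<b = nbhd x in mkInterval (<⇒≤ (<-≤-trans a<x (<⇒≤ x<b))) , a<x , x<b)
      , λ (I , a<x , x<b) (J , a′<x , x<b′) →
          let m , a≤m , a′≤m , m<x = upper-bound-below a<x a′<x
              n , x<n , n≤b , n≤b′ = lower-bound-above x<b x<b′
          in  (mkInterval (<⇒≤ (<-≤-trans m<x (<⇒≤ x<n))) , m<x , x<n)
            , (λ (m≤z , z≤n) → ≤-trans a≤m m≤z , ≤-trans z≤n n≤b)
            , (λ (m≤z , z≤n) → ≤-trans a′≤m m≤z , ≤-trans z≤n n≤b′)
    ub : ∀ (I : ∃ Around) → ⟦ singleton x ⟧ ⊆ ⟦ proj₁ I ⟧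
    ub (I , a<x , x<b) (x≤z , z≤x) = ≤-trans (<⇒≤ a<x) x≤z , ≤-trans z≤x (<⇒≤ x<b)
    least : ∀ J → (∀ (I : ∃ Around) → ⟦ J ⟧ ⊆ ⟦ proj₁ I ⟧) → ⟦ J ⟧ ⊆ ⟦ singleton x ⟧
    least J J⊆ {z} z∈J = mk≤ x⊆z , ≮⇒≥ x≮z
      where
      within : ∀ {a b} → a < x → x < b → a ≤ z × z ≤ b
      within a<x x<b = J⊆ (mkInterval (<⇒≤ (<-≤-trans a<x (<⇒≤ x<b))) , a<x , x<b) z∈J
      x⊆z : ∀ {p} → p ∈ ℝ.lower x → p ∈ ℝ.lower z
      x⊆z p∈x =
        let r , p<r , r∈x   = ℝ.rounded x p∈x
            _ , _ , _ , x<b = nbhd x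
        in  _≤_.incl (proj₁ (within (fromℚ-< x r∈x) x<b)) p<r
      x≮z : ¬ x < z
      x≮z (mk< q q∉x q∈z) =
        let r , q<r , r∈z   = ℝ.rounded z q∈z
            _ , _ , a<x , _ = nbhd x
        in  ℚ.<-irrefl refl (_≤_.incl (proj₂ (within a<x (fromℚ-> x q∉x q<r))) r∈z)

  lift-open : ∀ {V} → Space.IsOpen (Scott 𝐈ℝ⊥) V → Space.IsOpen (Scott 𝐈ℝ) (V ∘ [_])
  lift-open {V} V-open = record
    { upper        = λ I≤J → IsScottOpen.upper V-open AddInfimum.[ I≤J ]
    ; inaccessible = inacc
    }
    where
    inacc : ∀ (S : Pred Interval 0ℓ) {x} → IsDirectedSup 𝐈ℝ (members S) x → [ x ] ∈ V →
            ∃[ I ] (I ∈ S × [ I ] ∈ V)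
    inacc S {x} ((s₀ , dir) , ub , least) x∈V =
      case IsScottOpen.inaccessible V-open S⊥ (((([ proj₁ s₀ ] , proj₂ s₀)) , dir⊥) , ub⊥ , least⊥) x∈V of λ where
        ([ I ] , I∈S , I∈V) → I , I∈S , I∈V
      where
      open Poset 𝐈ℝ⊥ using () renaming (_≤_ to _⊑_)
      S⊥ : Pred (Interval ₋) 0ℓ
      S⊥ ⊥₋    = ⊥
      S⊥ [ I ] = I ∈ S
      dir⊥ : ∀ (I J : ∃ S⊥) → Σ[ K ∈ ∃ S⊥ ] (proj₁ I ⊑ proj₁ K × proj₁ J ⊑ proj₁ K)
      dir⊥ ([ I ] , I∈S) ([ J ] , J∈S) =
        let (K , K∈S) , I≤K , J≤K = dir (I , I∈S) (J , J∈S)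
        in  ([ K ] , K∈S) , AddInfimum.[ I≤K ] , AddInfimum.[ J≤K ]
      ub⊥ : ∀ (I : ∃ S⊥) → proj₁ I ⊑ [ x ]
      ub⊥ ([ I ] , I∈S) = AddInfimum.[ ub (I , I∈S) ]
      least⊥ : ∀ y → (∀ (I : ∃ S⊥) → proj₁ I ⊑ y) → [ x ] ⊑ y
      least⊥ ⊥₋    S≤y = case S≤y ([ proj₁ s₀ ] , proj₂ s₀) of λ ()
      least⊥ [ J ] S≤y = AddInfimum.[ least J (λ (I , I∈S) → AddInfimum.[≤]-injective _ (S≤y ([ I ] , I∈S))) ]

  module OnIntervals (v : Version) where
    𝐕ᵢ : Poset 1ℓ 1ℓ 1ℓ
    𝐕ᵢ = 𝐕 (Scott (IntervalDomain v))

    embedding : Continuous Euclidean (Scott (IntervalDomain v))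
    embedding = record { fun = interval v ∘ singleton ; preimage-open = preimage-open v }
      where
      preimage-open : ∀ v {V} → Space.IsOpen (Scott (IntervalDomain v)) V →
                      Space.IsOpen Euclidean (V ∘ interval v ∘ singleton)
      preimage-open plain  V-open = singleton-open V-open
      preimage-open lifted V-open = singleton-open (lift-open V-open)

    i[_] : BorelMeasure → Valuation (Scott (IntervalDomain v))
    i[ μ ] = image embedding (restriction μ)

    infix 9 _↾_

    -- μ ↾ {a₁ < … < aₙ} = Σ_{i=2}^{n} μ(]aᵢ₋₁,aᵢ]) δ_[aᵢ₋₁,aᵢ]
    _↾_ : BorelMeasure → Partition → Valuation (Scott (IntervalDomain v))
    μ ↾ P = steps (Partition.increasing P)
      where
      steps : ∀ {a as} → Linked _<_ (a ∷ as) → Valuation (Scott (IntervalDomain v))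
      steps [-]                     = 0ᵛ
      steps {a} {b ∷ _} (a<b ∷ b<…) =
        BorelMeasure.measure μ Borel-] a , b ] ·δ interval v (mkInterval (<⇒≤ a<b)) +ᵛ steps b<…

{-# OPTIONS --safe #-}

-- For a partition P and a Scott-open set U, μ_P(U) is the measure of the union
-- A_P(U) of those cells ]aᵢ₋₁,aᵢ] of P for which [aᵢ₋₁,aᵢ] ∈ U. Refining P
-- enlarges A_P(U), which stays inside i⁻¹(U); this gives (1) and μ_P ≤ i[μ].
-- When P ranges over the partitions inside a dense set, the interiors of the
-- sets A_P(U) form a directed family of open sets with union i⁻¹(U), so that
-- Scott continuity of the restriction of μ to the open sets yields the supremum.
-- Minimality follows because a combination of Dirac valuations with coefficients
-- in [0,+∞] is the directed supremum of those obtained by capping the coefficients.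
module Submission where

open import Defs
open import Axiom.ExcludedMiddle using (ExcludedMiddle)
open import Data.Empty using (⊥-elim)
open import Data.List.Base using (List; []; _∷_; _++_; map)
import Data.List.Membership.Setoid as SetoidMembership
import Data.List.Relation.Binary.Subset.Setoid as SetoidSubset
import Data.List.Relation.Binary.Subset.Setoid.Properties as Subset
open import Data.List.Relation.Unary.All as All using (All; []; _∷_)
open import Data.List.Relation.Unary.All.Properties using () renaming (++⁺ to All-++⁺)
open import Data.List.Relation.Unary.AllPairs using (AllPairs; []; _∷_)
open import Data.List.Relation.Unary.Any using (here; there)
open import Data.List.Relation.Unary.Linked using (Linked; [-]; _∷_)
open import Data.List.Relation.Unary.Linked.Properties using (AllPairs⇒Linked)
open import Data.Product.Base using (∃; ∃-syntax; Σ-syntax; _×_; _,_; proj₁; proj₂)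
open import Data.Rational.Base as ℚ using (ℚ; 0ℚ)
import Data.Rational.Properties as ℚ
open import Data.Sum.Base using (_⊎_; inj₁; inj₂)
open import Data.Unit.Polymorphic.Base using (⊤; tt)
open import Function.Base using (_∘_; id; case_of_)
open import Level using (0ℓ)
open import Relation.Binary.Bundles using (Poset; Setoid)
open import Relation.Binary.Definitions using (_Respects_)
open import Relation.Binary.PropositionalEquality.Core using (_≡_; refl; subst)
open import Relation.Nullary using (yes; no; ¬_; contradiction)
open import Relation.Unary using (Pred; _∈_; _⊆_; ∅; _∩_; _∪_)

open Setoid ℝ-setoid using () renaming (refl to ≈-refl)
open SetoidMembership ℝ-setoid using () renaming (_∈_ to _∈ₛ_)
open SetoidSubset ℝ-setoid using () renaming (_⊆_ to _⊆ₛ_)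
open Open using (pts; isOpen)
open Valuation using (value)
open Partition using (points; increasing)

-- Order and density on the real line.

<⇒≱ : ∀ {x y} → x < y → ¬ y ≤ x
<⇒≱ (mk< q q∉x q∈y) (mk≤ y≤x) = q∉x (y≤x q∈y)

<-trans : ∀ {x y z} → x < y → y < z → x < z
<-trans x<y y<z = <-≤-trans x<y (<⇒≤ y<z)

<-respʳ-≈ : ∀ {x} → (x <_) Respects _≈_
<-respʳ-≈ (y≤z , _) x<y = <-≤-trans x<y y≤z

<-dense : ∀ {x y} → x < y → ∃[ m ] (x < m × m < y)
<-dense {x} {y} (mk< q q∉x q∈y) =
  let r , q<r , r∈y = ℝ.rounded y q∈y in fromℚ r , fromℚ-> x q∉x q<r , fromℚ-< y r∈y

open-interval : ℝ → ℝ → Open Euclidean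
open-interval a b = mkOpen {pts = ] a , b [} λ x∈ → a , b , x∈ , id

dense-between : ∀ {D} → Dense D → ∀ {x y} → x < y → ∃[ d ] (d ∈ D × x < d × d < y)
dense-between dense {x} {y} x<y = dense (open-interval x y) (<-dense x<y)

head-minimum : ∀ {a as p} → Linked _<_ (a ∷ as) → p ∈ₛ a ∷ as → a ≤ p
head-minimum _           (here (_ , a≤p)) = a≤p
head-minimum (a<b ∷ b<…) (there p∈)       = ≤-trans (<⇒≤ a<b) (head-minimum b<… p∈)

-- Truncating extended reals at finite values.

cap : ℚ → ℝ̄₊ → ℝ̄₊
cap r c = record
  { cut = record
    -- The maximum with 0 keeps every negative rational in the cut, whatever the sign of `r`.
    { lower   = λ q → q ∈ ℝ̄₊.lower c × q ℚ.< r ℚ.⊔ 0ℚ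
    ; down    = λ p≤q (q∈c , q<r) → ℝ̄₊.down c p≤q q∈c , ℚ.≤-<-trans p≤q q<r
    ; rounded = λ (q∈c , q<r) →
        let s , q<s , s∈c = ℝ̄₊.rounded c q∈c
            t , q<t , t<r = ℚ.<-dense q<r
        in  case ℚ.≤-total s t of λ where
              (inj₁ s≤t) → s , q<s , s∈c , ℚ.≤-<-trans s≤t t<r
              (inj₂ t≤s) → t , q<t , ℝ̄₊.down c t≤s s∈c , t<r
    }
  ; nonneg = λ q<0 → ℝ̄₊.nonneg c q<0 , ℚ.<-≤-trans q<0 (ℚ.p≤q⊔p r 0ℚ)
  }

cap-finite : ∀ r c → IsFinite (cap r c)
cap-finite r c = r ℚ.⊔ 0ℚ , λ (_ , r<r) → ℚ.<-irrefl refl r<r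

cap-≤ : ∀ r c → cap r c ≤∞ c
cap-≤ r c = mk≤∞ proj₁

cap-mono : ∀ {r s} c → r ℚ.≤ s → cap r c ≤∞ cap s c
cap-mono c r≤s = mk≤∞ λ (q∈c , q<r) → q∈c , ℚ.<-≤-trans q<r (ℚ.⊔-monoˡ-≤ 0ℚ r≤s)

-- This makes `c` the supremum of its caps: roundedness supplies some `r` strictly above `q`.
∈-cap : ∀ c {q} → q ∈ ℝ̄₊.lower c → ∃[ r ] q ∈ ℝ̄₊.lower (cap r c)
∈-cap c q∈c =
  let r , q<r , _ = ℝ̄₊.rounded c q∈c in r , q∈c , ℚ.<-≤-trans q<r (ℚ.p≤p⊔q r 0ℚ)

-- Interiors of arbitrary subsets.

module _ (X : Space) (A : Pred (Space.Carrier X) 0ℓ) where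

  OpenWithin : Pred (Space.Carrier X) 1ℓ
  OpenWithin x = ∃[ V ] (Space.IsOpen X V × x ∈ V × V ⊆ A)

module _ (em : ∀ {ℓ} → ExcludedMiddle ℓ) where
  open Classical em

  ≤-total : ∀ x y → x ≤ y ⊎ y ≤ x
  ≤-total x y = case em {P = x < y} of λ where
    (yes x<y) → inj₁ (<⇒≤ x<y)
    (no x≮y)  → inj₂ (≮⇒≥ x≮y)

  -- `OpenWithin` quantifies over subsets and so lives one universe up; `⌈_⌉` brings it back to a
  -- `Set`-valued predicate.
  interior : ∀ X → Pred (Space.Carrier X) 0ℓ → Open X
  interior X A = mkOpen {pts = ⌈ OpenWithin X A ⌉} (Space.⋃-open X λ x∈ →
    let V , V-open , x∈V , V⊆A = from⌈⌉ {P = OpenWithin X A} x∈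
    in  V , V-open , x∈V , λ y∈V → to⌈⌉ (V , V-open , y∈V , λ {_} → V⊆A))

  interior-⊆ : ∀ {X A} → pts (interior X A) ⊆ A
  interior-⊆ {X} {A} x∈ = let _ , _ , x∈V , V⊆A = from⌈⌉ {P = OpenWithin X A} x∈ in V⊆A x∈V

  interior-mono : ∀ {X A B} → A ⊆ B → pts (interior X A) ⊆ pts (interior X B)
  interior-mono {X} {A} A⊆B x∈ =
    let V , V-open , x∈V , V⊆A = from⌈⌉ {P = OpenWithin X A} x∈
    in  to⌈⌉ (V , V-open , x∈V , λ {_} y∈V → A⊆B (V⊆A y∈V))

  interior-max : ∀ {X A} (V : Open X) → pts V ⊆ A → pts V ⊆ pts (interior X A)
  interior-max V V⊆A x∈V = to⌈⌉ (pts V , isOpen V , x∈V , λ {_} → V⊆A)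

  -- Partitions with prescribed points

  -- Excluded middle gives trichotomy. A point `≈` to one already present is dropped, so that the
  -- order stays strict and the points are kept only up to `≈`.
  insert : ∀ x {xs} → AllPairs _<_ xs →
           ∃[ ys ] (AllPairs _<_ ys × ys ⊆ₛ x ∷ xs × x ∷ xs ⊆ₛ ys)
  insert x [] = x ∷ [] , [] ∷ [] , id , id
  insert x {y ∷ ys} (y<ys ∷ ys<) with em {P = x < y} | em {P = y < x}
  ... | yes x<y | _ =
    x ∷ y ∷ ys , (x<y ∷ All.map (<-trans x<y) y<ys) ∷ y<ys ∷ ys< , id , id
  ... | no _ | yes y<x =
    let zs , zs< , zs⊆ , ⊆zs = insert x ys<
    in  y ∷ zs
      -- Every point of `zs` is `≈` to `x` or to a point of `ys`, and `y` is below all of these.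
      , Subset.All-resp-⊇ ℝ-setoid <-respʳ-≈ zs⊆ (y<x ∷ y<ys) ∷ zs<
      , (λ where (here p)  → there (here p)
                 (there p) → case zs⊆ p of λ where
                   (here q)  → here q
                   (there q) → there (there q))
      , (λ where (here p)          → there (⊆zs (here p))
                 (there (here p))  → here p
                 (there (there p)) → there (⊆zs (there p)))
  ... | no x≮y | no y≮x =
    y ∷ ys , y<ys ∷ ys< , there , Subset.∈-∷⁺ʳ ℝ-setoid (here (≮⇒≥ y≮x , ≮⇒≥ x≮y)) id

  strictly-sorted : ∀ xs → ∃[ ys ] (AllPairs _<_ ys × ys ⊆ₛ xs × xs ⊆ₛ ys)
  strictly-sorted []       = [] , [] , id , id
  strictly-sorted (x ∷ xs) =
    let ys , ys< , ys⊆ , ⊆ys = strictly-sorted xs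
        zs , zs< , zs⊆ , ⊆zs = insert x ys<
    in  zs , zs<
      , (λ p → Subset.∷⁺ʳ ℝ-setoid x ys⊆ (zs⊆ p))
      , (λ p → ⊆zs (Subset.∷⁺ʳ ℝ-setoid x ⊆ys p))

  partition : ∀ x xs → ∃[ P ] (points P ⊆ₛ x ∷ xs × x ∷ xs ⊆ₛ points P)
  partition x xs with strictly-sorted (x ∷ xs)
  ... | []     , _   , _   , ⊆ys = case ⊆ys (here ≈-refl) of λ ()
  ... | y ∷ ys , ys< , ys⊆ , ⊆ys =
    record { increasing = AllPairs⇒Linked ys< } , ys⊆ , ⊆ys

  infixr 6 _∪ₚ_

  -- Splitting off the head exhibits non-emptiness; the list passed to `partition` computes to
  -- `points P ++ points Q`.
  _∪ₚ_ : Partition → Partition → Partition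
  P ∪ₚ Q = proj₁ (partition (Partition.first P) (Partition.rest P ++ points Q))

  ∪ₚ-upperˡ : ∀ P Q → P ⊆ₚ P ∪ₚ Q
  ∪ₚ-upperˡ P Q p = proj₂ (proj₂ (partition _ _)) (Subset.xs⊆xs++ys ℝ-setoid (points P) _ p)

  ∪ₚ-upperʳ : ∀ P Q → Q ⊆ₚ P ∪ₚ Q
  ∪ₚ-upperʳ P Q q = proj₂ (proj₂ (partition _ _)) (Subset.xs⊆ys++xs ℝ-setoid _ (points P) q)

  -- Minimality of combinations with coefficients in [0,+∞]

  module _ {X : Space} where

    ·δ-∈ : ∀ c {x} (U : Open X) → x ∈ pts U → value (c ·δ x) U ≈∞ c
    ·δ-∈ c {x} U x∈U with em {P = x ∈ pts U}
    ... | yes _  = ≈∞.refl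
    ... | no x∉U = contradiction x∈U x∉U

    ·δ-∉ : ∀ c {x} (U : Open X) → ¬ x ∈ pts U → value (c ·δ x) U ≈∞ 0∞
    ·δ-∉ c {x} U x∉U with em {P = x ∈ pts U}
    ... | yes x∈U = contradiction x∈U x∉U
    ... | no _    = ≈∞.refl

    ·δ-mono : ∀ {c d} x → c ≤∞ d → Poset._≤_ (𝐕 X) (c ·δ x) (d ·δ x)
    ·δ-mono x c≤d U with em {P = x ∈ pts U}
    ... | yes _ = c≤d
    ... | no _  = ≤∞-refl

    -- Coefficients may be +∞ here, unlike in `IsSimple`, since a cell may have infinite measure.
    combination : List (ℝ̄₊ × Space.Carrier X) → Valuation X
    combination []             = 0ᵛ
    combination ((c , x) ∷ ts) = c ·δ x +ᵛ combination ts

    capped : ℚ → List (ℝ̄₊ × Space.Carrier X) → Valuation X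
    capped r ts = combination (map (λ (c , x) → cap r c , x) ts)

    capped-simple : ∀ r ts → IsSimple (capped r ts)
    capped-simple r []             = [] , λ U → ≈∞.refl
    capped-simple r ((c , x) ∷ ts) =
      let fs , ≈fs = capped-simple r ts
      in  ((cap r c , cap-finite r c) , x) ∷ fs , λ U → +∞.∙-cong ≈∞.refl (≈fs U)

    capped-≤ : ∀ r ts → Poset._≤_ (𝐕 X) (capped r ts) (combination ts)
    capped-≤ r []             U = ≤∞-refl
    capped-≤ r ((c , x) ∷ ts) U = +∞-mono (·δ-mono x (cap-≤ r c) U) (capped-≤ r ts U)

    capped-mono : ∀ {r s} → r ℚ.≤ s → ∀ ts → Poset._≤_ (𝐕 X) (capped r ts) (capped s ts)
    capped-mono r≤s []             U = ≤∞-refl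
    capped-mono r≤s ((c , x) ∷ ts) U = +∞-mono (·δ-mono x (cap-mono c r≤s) U) (capped-mono r≤s ts U)

    -- Each of the finitely many terms needs some cap; the maximum of these serves all terms, as
    -- capping is monotone.
    ∈-capped : ∀ ts U {q} → q ∈ ℝ̄₊.lower (value (combination ts) U) →
               ∃[ r ] q ∈ ℝ̄₊.lower (value (capped r ts) U)
    ∈-capped []             U q∈ = 0ℚ , q∈
    ∈-capped ((c , x) ∷ ts) U (q₁ , q₂ , q₁∈ , q₂∈ , q≤) =
      let r , q₁∈r = head q₁∈
          s , q₂∈s = ∈-capped ts U q₂∈
      in  r ℚ.⊔ s , q₁ , q₂
        , _≤∞_.incl (·δ-mono x (cap-mono c (ℚ.p≤p⊔q r s)) U) q₁∈r
        , _≤∞_.incl (capped-mono (ℚ.p≤q⊔p r s) ts U) q₂∈s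
        , q≤
      where
      head : ∀ {q} → q ∈ ℝ̄₊.lower (value (c ·δ x) U) → ∃[ r ] q ∈ ℝ̄₊.lower (value (cap r c ·δ x) U)
      head q∈ with em {P = x ∈ pts U}
      ... | yes _ = ∈-cap c q∈
      ... | no _  = 0ℚ , q∈

    -- `directed-sup` expects a `Set`-valued predicate, whereas families may have large index types;
    -- the range is therefore squashed. Taking it up to `≡` lets minimality transport by `subst`.
    directed-sup-family : ∀ {i} {I : Set i} {f : I → Valuation X} {ν} →
                          (∀ i → IsMinimal (f i)) → IsDirectedSup (𝐕 X) f ν → IsMinimal ν
    directed-sup-family {f = f} {μ} f-minimal ((i₀ , dir) , ub , least) = directed-sup Range
      (λ ν∈ → let i , fi≡ν = from⌈⌉ ν∈ in subst IsMinimal fi≡ν (f-minimal i))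
      ( ( inRange i₀
        , λ (ν , ν∈) (ξ , ξ∈) →
            let i , fi≡ν = from⌈⌉ ν∈
                j , fj≡ξ = from⌈⌉ ξ∈
                k , i≤k , j≤k = dir i j
            in  inRange k , subst (_≤ᵛ f k) fi≡ν i≤k , subst (_≤ᵛ f k) fj≡ξ j≤k )
      , (λ (ν , ν∈) → let i , fi≡ν = from⌈⌉ ν∈ in subst (_≤ᵛ μ) fi≡ν (ub i))
      , λ ξ Range≤ξ → least ξ (λ i → Range≤ξ (inRange i)) )
      where
      open Poset (𝐕 X) using () renaming (_≤_ to _≤ᵛ_)
      Range : Pred (Valuation X) 0ℓ
      Range = ⌈ (λ ν → ∃[ i ] f i ≡ ν) ⌉
      inRange : ∀ i → ∃ Range
      inRange i = f i , to⌈⌉ (i , refl)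

    combination-minimal : ∀ ts {ν} → Poset._≈_ (𝐕 X) ν (combination ts) → IsMinimal ν
    combination-minimal ts {ν} ν≈ = directed-sup-family {f = λ r → capped r ts} (λ r → simple (capped-simple r ts))
      ( ( 0ℚ
        , λ r s → r ℚ.⊔ s , capped-mono (ℚ.p≤p⊔q r s) ts , capped-mono (ℚ.p≤q⊔p r s) ts )
      , (λ r U → ≤∞-trans (capped-≤ r ts U) (proj₂ (ν≈ U)))
      , λ ξ capped≤ξ U → ≤∞-trans (proj₁ (ν≈ U)) (mk≤∞ λ q∈ →
          let r , q∈r = ∈-capped ts U q∈ in _≤∞_.incl (capped≤ξ r U) q∈r) )

  -- Cells of a partition

  -- A_P(U) for the increasing list of points of P, where W is the trace of U
  -- on the intervals.
  covered : Pred Interval 0ℓ → ∀ {a as} → Linked _<_ (a ∷ as) → Pred ℝ 0ℓ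
  covered W [-]                     = ∅
  covered W {a} {b ∷ _} (a<b ∷ b<…) =
    (] a , b ] ∩ λ _ → mkInterval (<⇒≤ a<b) ∈ W) ∪ covered W b<…

  -- That `c` and `d` are consecutive is deliberately forgotten: what remains survives adding
  -- points, and `∈-covered` recovers a cell from it.
  covered-cell : ∀ {W a as} (l : Linked _<_ (a ∷ as)) {x} → x ∈ covered W l →
    ∃[ c ] ∃[ d ] Σ[ c≤d ∈ c ≤ d ]
      (c ∈ₛ a ∷ as × d ∈ₛ a ∷ as × c < x × x ≤ d × mkInterval c≤d ∈ W)
  covered-cell (a<b ∷ _) (inj₁ ((a<x , x≤b) , ∈W)) =
    _ , _ , <⇒≤ a<b , here ≈-refl , there (here ≈-refl) , a<x , x≤b , ∈W
  covered-cell (_ ∷ b<…) (inj₂ x∈) =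
    let c , d , c≤d , c∈ , d∈ , rest = covered-cell b<… x∈
    in  c , d , c≤d , there c∈ , there d∈ , rest

  module _ {W : Pred Interval 0ℓ} (W-upper : ∀ {I J} → Poset._≤_ 𝐈ℝ I J → I ∈ W → J ∈ W) where

    -- The cell that contains `x` has its closed interval inside [c,d], even when `c` and `d` are
    -- not consecutive; `W-upper` then puts that interval in `W`.
    ∈-covered : ∀ {a as} (l : Linked _<_ (a ∷ as)) {c d x} → c ∈ₛ a ∷ as → d ∈ₛ a ∷ as →
                (c≤d : c ≤ d) → c < x → x ≤ d → mkInterval c≤d ∈ W → x ∈ covered W l
    -- If `d` is the least point, then x ≤ d ≤ c, against c < x.
    ∈-covered l c∈ (here (d≤a , _)) _ c<x x≤d _ =
      contradiction (≤-trans x≤d (≤-trans d≤a (head-minimum l c∈))) (<⇒≱ c<x)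
    ∈-covered {a} {b ∷ _} (a<b ∷ b<…) {c} {d} {x} c∈ (there d∈) c≤d c<x x≤d ∈W
      with em {P = b < x} | c∈
    ... | yes b<x | there c∈′       = inj₂ (∈-covered b<… c∈′ d∈ c≤d c<x x≤d ∈W)
    -- `x` lies beyond the first cell, so the left end moves from `c` to `b`, which shrinks the
    -- interval.
    ... | yes b<x | here (c≤a , _)  =
      inj₂ (∈-covered b<… (here ≈-refl) d∈ (<⇒≤ (<-≤-trans b<x x≤d)) b<x x≤d
        (W-upper (λ (b≤z , z≤d) → ≤-trans c≤a (≤-trans (<⇒≤ a<b) b≤z) , z≤d) ∈W))
    ... | no b≮x  | there c∈′       = contradiction (≤-<-trans (head-minimum b<… c∈′) c<x) b≮x
    -- `x` lies in the first cell, and [a,b] is inside [c,d] because `d` is a later point than `a`.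
    ... | no b≮x  | here (c≤a , a≤c) =
      inj₁ ( (≤-<-trans a≤c c<x , ≮⇒≥ b≮x)
           , W-upper (λ (a≤z , z≤b) → ≤-trans c≤a a≤z , ≤-trans z≤b (head-minimum b<… d∈)) ∈W )

    covered-mono : ∀ {a as b bs} (k : Linked _<_ (a ∷ as)) (l : Linked _<_ (b ∷ bs)) →
                   a ∷ as ⊆ₛ b ∷ bs → covered W k ⊆ covered W l
    covered-mono k l k⊆l x∈ =
      let _ , _ , c≤d , c∈ , d∈ , c<x , x≤d , ∈W = covered-cell k x∈
      in  ∈-covered l (k⊆l c∈) (k⊆l d∈) c≤d c<x x≤d ∈W

    covered-⊆ : ∀ {a as} (l : Linked _<_ (a ∷ as)) → covered W l ⊆ W ∘ singleton
    covered-⊆ l x∈ =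
      let _ , _ , _ , _ , _ , c<x , x≤d , ∈W = covered-cell l x∈
      in  W-upper (λ (x≤z , z≤x) → ≤-trans (<⇒≤ c<x) x≤z , ≤-trans z≤x x≤d) ∈W

  -- Classically the set is either `A` or empty.
  Borel-when : ∀ {A} (P : Set) → Borel A → Borel (A ∩ λ _ → P)
  Borel-when P a = case em {P = P} of λ where
    (yes p) → resp ((λ x∈A → x∈A , p) , proj₁) a
    (no ¬p) → resp ((λ ()) , λ (_ , p) → ⊥-elim (¬p p)) Borel-∅

  Borel-covered : ∀ W {a as} (l : Linked _<_ (a ∷ as)) → Borel (covered W l)
  Borel-covered W [-]                     = Borel-∅
  Borel-covered W {a} {b ∷ _} (a<b ∷ b<…) =
    Borel-∪ (Borel-when _ Borel-] a , b ]) (Borel-covered W b<…)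

  -- Reduces both versions to `𝐈ℝ`: the Dirac masses of μ_P and the image of `i` all sit at
  -- intervals, so only the trace of an open set on these matters.
  interval-open : ∀ v {V} → IsScottOpen (IntervalDomain v) V → IsScottOpen 𝐈ℝ (V ∘ interval v)
  interval-open plain  V-open = V-open
  interval-open lifted V-open = lift-open V-open

  -- A singleton is the directed supremum of the intervals around it with end
  -- points in D.
  dense-neighbourhood :
    ∀ {D} → Dense D → ∀ {W} → IsScottOpen 𝐈ℝ W → ∀ {x} → singleton x ∈ W →
    ∃[ I ] (Interval.lo I ∈ D × Interval.hi I ∈ D × x ∈ ] Interval.lo I , Interval.hi I [ × I ∈ W)
  dense-neighbourhood {D} dense W-open {x} x∈W =
    let I , (lo∈D , hi∈D , x∈I) , I∈W =
          IsScottOpen.inaccessible W-open Around ((inhabited , directed) , ub , least) x∈W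
    in  I , lo∈D , hi∈D , x∈I , I∈W
    where
    Around : Pred Interval 0ℓ
    Around I = Interval.lo I ∈ D × Interval.hi I ∈ D × x ∈ ] Interval.lo I , Interval.hi I [
    around : ∀ {a b} → a ∈ D → b ∈ D → a < x → x < b → ∃ Around
    around a∈D b∈D a<x x<b = mkInterval (<⇒≤ (<-trans a<x x<b)) , a∈D , b∈D , a<x , x<b
    below : ∃[ a ] (a ∈ D × a < x)
    below = let _ , _ , a<x , _ = nbhd x
                d , d∈D , _ , d<x = dense-between dense a<x in d , d∈D , d<x
    above : ∃[ b ] (b ∈ D × x < b)
    above = let _ , _ , _ , x<b = nbhd x
                d , d∈D , x<d , _ = dense-between dense x<b in d , d∈D , x<d
    inhabited : ∃ Around
    inhabited = let _ , a∈D , a<x = below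
                    _ , b∈D , x<b = above in around a∈D b∈D a<x x<b
    -- Totality of the order makes one of the two given points the bound, which thus stays in `D`.
    max : ∀ {a b} → a ∈ D → b ∈ D → a < x → b < x → ∃[ m ] (m ∈ D × m < x × a ≤ m × b ≤ m)
    max {a} {b} a∈D b∈D a<x b<x = case ≤-total a b of λ where
      (inj₁ a≤b) → b , b∈D , b<x , a≤b , ≤-refl
      (inj₂ b≤a) → a , a∈D , a<x , ≤-refl , b≤a
    min : ∀ {a b} → a ∈ D → b ∈ D → x < a → x < b → ∃[ m ] (m ∈ D × x < m × m ≤ a × m ≤ b)
    min {a} {b} a∈D b∈D x<a x<b = case ≤-total a b of λ where
      (inj₁ a≤b) → a , a∈D , x<a , ≤-refl , a≤b
      (inj₂ b≤a) → b , b∈D , x<b , b≤a , ≤-refl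
    directed : ∀ (I J : ∃ Around) →
               Σ[ K ∈ ∃ Around ] (⟦ proj₁ K ⟧ ⊆ ⟦ proj₁ I ⟧ × ⟦ proj₁ K ⟧ ⊆ ⟦ proj₁ J ⟧)
    directed (I , a∈D , b∈D , a<x , x<b) (J , a′∈D , b′∈D , a′<x , x<b′) =
      let m , m∈D , m<x , a≤m , a′≤m = max a∈D a′∈D a<x a′<x
          n , n∈D , x<n , n≤b , n≤b′ = min b∈D b′∈D x<b x<b′
      in  around m∈D n∈D m<x x<n
        , (λ (m≤z , z≤n) → ≤-trans a≤m m≤z , ≤-trans z≤n n≤b)
        , (λ (m≤z , z≤n) → ≤-trans a′≤m m≤z , ≤-trans z≤n n≤b′)
    ub : ∀ (I : ∃ Around) → ⟦ singleton x ⟧ ⊆ ⟦ proj₁ I ⟧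
    ub (I , _ , _ , a<x , x<b) (x≤z , z≤x) = ≤-trans (<⇒≤ a<x) x≤z , ≤-trans z≤x (<⇒≤ x<b)
    least : ∀ J → (∀ (I : ∃ Around) → ⟦ J ⟧ ⊆ ⟦ proj₁ I ⟧) → ⟦ J ⟧ ⊆ ⟦ singleton x ⟧
    least J J⊆ {z} z∈J = ≮⇒≥ z≮x , ≮⇒≥ x≮z
      where
      -- A point of `D` strictly between `z` and `x` is the left end of an interval around `x` that
      -- excludes `z`.
      z≮x : ¬ z < x
      z≮x z<x =
        let _ , a∈D , z<a , a<x = dense-between dense z<x
            _ , b∈D , x<b       = above
        in  <⇒≱ z<a (proj₁ (J⊆ (around a∈D b∈D a<x x<b) z∈J))
      x≮z : ¬ x < z
      x≮z x<z =
        let _ , a∈D , a<x       = below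
            _ , b∈D , x<b , b<z = dense-between dense x<z
        in  <⇒≱ b<z (proj₂ (J⊆ (around a∈D b∈D a<x x<b) z∈J))

  -- The valuations μ_P as measures of covered sets, and their supremum.

  module _ (v : Version) (μ : BorelMeasure) where
    open OnIntervals v
    open BorelMeasure μ
    open Poset 𝐕ᵢ using () renaming (_≈_ to _≈ᵛ_; _≤_ to _≤ᵛ_)

    terms : ∀ {a as} → Linked _<_ (a ∷ as) → List (ℝ̄₊ × Poset.Carrier (IntervalDomain v))
    terms [-]                     = []
    terms {a} {b ∷ _} (a<b ∷ b<…) =
      (measure Borel-] a , b ] , interval v (mkInterval (<⇒≤ a<b))) ∷ terms b<…

    ↾-combination : ∀ {a as} (l : Linked _<_ (a ∷ as)) →
                    μ ↾ record { increasing = l } ≈ᵛ combination (terms l)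
    ↾-combination [-]       U = ≈∞.refl
    ↾-combination (_ ∷ b<…) U = +∞.∙-cong ≈∞.refl (↾-combination b<… U)

    ↾-minimal : ∀ P → IsMinimal (μ ↾ P)
    ↾-minimal P = combination-minimal (terms (increasing P)) (↾-combination (increasing P))

    module _ (U : Open (Scott (IntervalDomain v))) where

      on-intervals : Pred Interval 0ℓ
      on-intervals I = interval v I ∈ pts U

      on-intervals-open : IsScottOpen 𝐈ℝ on-intervals
      on-intervals-open = interval-open v (isOpen U)

      -- Half-open cells are disjoint, so the sum is a measure by additivity; a cell whose interval
      -- is outside `U` contributes 0 to both sides.
      combination-measure : ∀ {a as} (l : Linked _<_ (a ∷ as)) →
        value (combination (terms l)) U ≈∞ measure (Borel-covered on-intervals l)
      combination-measure [-] = ≈∞.sym (measure-∅ Borel-∅)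
      combination-measure {a} {b ∷ _} (a<b ∷ b<…) = ≈∞.trans
        (+∞.∙-cong cell (combination-measure b<…))
        (≈∞.sym (additive μ (Borel-when _ Borel-] a , b ]) (Borel-covered on-intervals b<…) _
          -- A later cell has left end c with b ≤ c < x, whereas the first one requires x ≤ b.
          (λ (((_ , x≤b) , _) , x∈) →
            let _ , _ , _ , c∈ , _ , c<x , _ = covered-cell b<… x∈
            in  <⇒≱ (≤-<-trans (head-minimum b<… c∈) c<x) x≤b)
          (id , id)))
        where
        I = mkInterval (<⇒≤ a<b)
        cell : value (measure Borel-] a , b ] ·δ interval v I) U
               ≈∞ measure (Borel-when (I ∈ on-intervals) Borel-] a , b ])
        cell = case em {P = I ∈ on-intervals} of λ where
          (yes I∈) → ≈∞.trans (·δ-∈ _ U I∈) (cong-≐ _ _ ((λ x∈ → x∈ , I∈) , proj₁))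
          (no I∉)  → ≈∞.trans (·δ-∉ _ U I∉) (≈∞.trans (≈∞.sym (measure-∅ Borel-∅))
                       (cong-≐ _ _ ((λ ()) , λ (_ , I∈) → ⊥-elim (I∉ I∈))))

      ↾-measure : ∀ P → value (μ ↾ P) U ≈∞ measure (Borel-covered on-intervals (increasing P))
      ↾-measure P = ≈∞.trans (↾-combination (increasing P) U)
                      (combination-measure (increasing P))

    ↾-mono : ∀ P Q → P ⊆ₚ Q → μ ↾ P ≤ᵛ μ ↾ Q
    ↾-mono P Q P⊆Q U = ≤∞-trans (proj₁ (↾-measure U P)) (≤∞-trans
      (measure-mono μ _ _ (covered-mono (IsScottOpen.upper (on-intervals-open U))
        (increasing P) (increasing Q) P⊆Q))
      (proj₂ (↾-measure U Q)))

    ↾-≤-image : ∀ P → μ ↾ P ≤ᵛ i[ μ ]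
    ↾-≤-image P U = ≤∞-trans (proj₁ (↾-measure U P))
      (measure-mono μ _ _ (covered-⊆ (IsScottOpen.upper (on-intervals-open U)) (increasing P)))

    module _ (D : Pred ℝ 0ℓ) (D-resp : D Respects _≈_) (dense : Dense D) where

      PartitionIn : Set₁
      PartitionIn = ∃ λ P → All D (points P)

      -- Density applied to the whole line yields a point of `D`, and a single point is already a
      -- partition.
      partition-in : PartitionIn
      partition-in =
        let _ , d∈D , _ = dense (mkOpen (Space.whole-open Euclidean)) (fromℚ 0ℚ , tt)
        in  record { increasing = [-] } , d∈D ∷ []

      -- The points of `P ∪ₚ Q` come from `P` and `Q` only up to `≈`; `D-resp` keeps them in `D`.
      join : ∀ (P Q : PartitionIn) →
             Σ[ R ∈ PartitionIn ] (proj₁ P ⊆ₚ proj₁ R × proj₁ Q ⊆ₚ proj₁ R)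
      join (P , P⊆D) (Q , Q⊆D) =
          ( P ∪ₚ Q
          , Subset.All-resp-⊇ ℝ-setoid D-resp (proj₁ (proj₂ (partition _ _))) (All-++⁺ P⊆D Q⊆D))
        , (λ {_} → ∪ₚ-upperˡ P Q) , (λ {_} → ∪ₚ-upperʳ P Q)

      -- Scott continuity speaks of open sets, while covered sets are unions of half-open cells.
      -- Passing to interiors may lose measure for a single partition, but not in the supremum.
      image-least : ∀ ν → (∀ (P : PartitionIn) → μ ↾ proj₁ P ≤ᵛ ν) → i[ μ ] ≤ᵛ ν
      image-least ν ↾≤ν U = proj₂ (preserves-family
          (Valuation.scott-continuous (restriction μ)) {g = inside}
          {Continuous.preimage embedding U} directed-union)
        (value ν U)
        λ P → ≤∞-trans (measure-mono μ _ (Borel-covered W (increasing (proj₁ P)))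
                        (interior-⊆ {Euclidean}))
                (≤∞-trans (proj₂ (↾-measure U (proj₁ P))) (↾≤ν P U))
        where
        W : Pred Interval 0ℓ
        W = on-intervals U
        W-upper : ∀ {I J} → Poset._≤_ 𝐈ℝ I J → I ∈ W → J ∈ W
        W-upper {I} {J} = IsScottOpen.upper (on-intervals-open U) {I} {J}
        inside : PartitionIn → Open Euclidean
        inside (P , _) = interior Euclidean (covered W (increasing P))
        inside-mono : ∀ P Q → proj₁ P ⊆ₚ proj₁ Q → pts (inside P) ⊆ pts (inside Q)
        inside-mono (P , _) (Q , _) P⊆Q =
          interior-mono {Euclidean} (covered-mono W-upper (increasing P) (increasing Q) P⊆Q)
        directed-union : IsDirectedSup (𝒪 Euclidean) inside (Continuous.preimage embedding U)
        directed-union =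
            ( partition-in
            , λ P Q →
                let R , P⊆R , Q⊆R = join P Q
                in  R , inside-mono P R P⊆R , inside-mono Q R Q⊆R )
          , (λ P x∈ → covered-⊆ W-upper (increasing (proj₁ P)) (interior-⊆ {Euclidean} x∈))
          , λ V inside⊆V x∈W →
              let I , a∈D , b∈D , x∈I@(a<x , x<b) , I∈W =
                    dense-neighbourhood dense (on-intervals-open U) x∈W
                  a<b = <-trans a<x x<b
                  -- Two points of `D` around `x` suffice: `x` is interior to the only cell.
                  P = record { increasing = a<b ∷ [-] } , a∈D ∷ b∈D ∷ []
              in  inside⊆V P (interior-max (open-interval _ _)
                    -- `W-upper id` replaces the proof of lo ≤ hi carried by `I` with the one that
                    -- the cell carries.
                    (λ (a<y , y<b) → inj₁ ((a<y , <⇒≤ y<b) , W-upper id I∈W)) x∈I)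

      ↾-directed-sup : IsDirectedSup 𝐕ᵢ (λ (P : PartitionIn) → μ ↾ proj₁ P) i[ μ ]
      ↾-directed-sup =
          ( partition-in
          , λ P Q →
              let R , P⊆R , Q⊆R = join P Q
              in  R , ↾-mono (proj₁ P) (proj₁ R) P⊆R , ↾-mono (proj₁ Q) (proj₁ R) Q⊆R )
        , (λ P → ↾-≤-image (proj₁ P))
        , image-least

    -- The case where `D` is all of ℝ, with the trivial membership proofs removed from the index.
    ↾-directed-sup-all : IsDirectedSup 𝐕ᵢ (λ P → μ ↾ P) i[ μ ]
    ↾-directed-sup-all =
      let ((P , _) , dir) , ub , least =
            ↾-directed-sup (λ _ → ⊤) (λ _ _ → tt) λ _ (x , x∈U) → x , tt , x∈U
      in  ( P
          , λ Q R →
              let (S , _) , Q≤S , R≤S = dir (Q , All.universal (λ _ → tt) _) (R , All.universal (λ _ → tt) _)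
              in  S , Q≤S , R≤S )
        , ↾-≤-image
        , λ ν ↾≤ν → least ν (λ P → ↾≤ν (proj₁ P))

theorem6p7 : (em : ∀ {ℓ} → ExcludedMiddle ℓ) (v : Version) (μ : BorelMeasure) →
    let open Classical.OnIntervals em v in
    (∀ P Q → P ⊆ₚ Q → Poset._≤_ 𝐕ᵢ (μ ↾ P) (μ ↾ Q))
    × (IsDirectedSup 𝐕ᵢ (λ P → μ ↾ P) i[ μ ] × Classical.IsMinimal em i[ μ ])
    × (∀ (D : Pred ℝ 0ℓ) → D Respects _≈_ → Dense D →
    IsDirectedSup 𝐕ᵢ (λ (P : ∃ λ P → All D (Partition.points P)) → μ ↾ proj₁ P) i[ μ ])
theorem6p7 em v μ =
    ↾-mono em v μ
  , ( ↾-directed-sup-all em v μ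
    , directed-sup-family em (↾-minimal em v μ) (↾-directed-sup-all em v μ) )
  , ↾-directed-sup em v μ
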